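{- $\mathcal L_{\mathsf{Canco}}\preceq\mathcal L_{\mathsf{Hasco}}\preceq\mathcal L_{\mathsf{Eq}}\preceq\mathcal L_{\mathsf{Canco}}$, where for logics $\mathcal L_1,\mathcal L_2$ the relation $\mathcal L_1\preceq\mathcal L_2$ means that for all $TCCS^m$ processes $P,Q$, $\mathcal L_2(P)=\mathcal L_2(Q)$ implies $\mathcal L_1(P)=\mathcal L_1(Q)$.
   Context: LANGUAGE. $\mathsf{Act}$ is an infinite set of actions with CCS complementation ($\bar{\bar a}=a$); $\tau\notin\mathsf{Act}$; $\mu$ ranges over $\mathsf{Act}\cup\{\tau\}$. Transaction names: $\mathsf{TrN}=\mathsf{inTrN}\uplus\mathsf{exTrN}$ (internal and external names, both infinite). Terms: $P,Q::=\sum_{i\in J}\mu_i.P_i$ ($J$ countable; $\mathbf 0$ is the empty sum) $\mid P\mid Q\mid\nu a.P\mid X\mid\mathrm{rec}X.P\mid[\![P\triangleright_kQ]\!]$ (running transaction named $k$) $\mid\mathrm{co}\mid[\![P\blacktriangleright Q]\!]$ (dormant transaction). $ftn(o)$ is the set of transaction names in $o$; $o\,\sharp\,o'$ means no transaction name of $o$ occurs in $o'$. A process is a well-formed term: (1) it is closed (no free process variables); (2) $ftn$ of it is finite; and for all subterms $[\![P_1\triangleright_kP_1']\!]$, $[\![P_2\blacktriangleright P_2']\!]$, $\sum\mu_i.Q_i$, $\mathrm{rec}X.R$: (3) $P_1,P_1',P_2,P_2',Q_i,R$ contain no transaction names; (4) $P_1,P_2,Q_i$ contain no dormant transactions; (5)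 $P_1,P_2$ are closed. PROCESS TRANSITIONS. $P\xrightarrow{\alpha}_\sigma Q$ with $\alpha\in\{a,\tau,k(\tau),k(a)\}$ and $\sigma$ a name substitution $\tilde k\mapsto l$ (domain the finite tuple $\tilde k$, possibly empty, range $\{l\}$; $\varepsilon$ alone is the empty substitution). Rules (symmetric ones omitted): - $\sum\mu_i.P_i\xrightarrow{\mu_j}_\varepsilon P_j$; - if $P\xrightarrow{a}_\varepsilon P'$ and $Q\xrightarrow{\bar a}_\varepsilon Q'$ then $P\mid Q\xrightarrow{\tau}_\varepsilon P'\mid Q'$; - $\mathrm{rec}X.P\xrightarrow{\tau}_\varepsilon P[\mathrm{rec}X.P/X]$; - if $\mu_j=a$ then $\sum\mu_i.P_i\xrightarrow{k(a)}_{\varepsilon\mapsto k}[\![P_j\mid\mathrm{co}\triangleright_k\sum\mu_i.P_i]\!]$; - if $P\xrightarrow{\mu}_\varepsilon P'$ and $k\,\sharp\,l$ then $[\![P\triangleright_lQ]\!]\xrightarrow{k(\mu)}_{l\mapsto k}[\![P'\triangleright_kQ]\!]$; - if $P\xrightarrow{k(a)}_{\sigma_1}P'$, $Q\xrightarrow{k(\bar a)}_{\sigma_2}Q'$, $\sigma_i=\tilde l_i\mapsto k$, then $P\mid Q\xrightarrow{k(\tau)}_{(\tilde l_1,\tilde l_2)\mapsto k}P'\sigma_2\mid Q'\sigma_1$; - if $P\xrightarrow{\alpha}_\sigma P'$ and $range(\sigma)\,\sharp\,Q$ then $P\mid Q\xrightarrow{\alpha}_\sigma P'\mid Q\sigma$;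 - if $P\xrightarrow{\alpha}_\sigma P'$ and $a$ does not occur in $\alpha$ then $\nu a.P\xrightarrow{\alpha}_\sigma\nu a.P'$. Reconfiguration transitions $P\xrightarrow{\beta}Q$, $\beta\in\{\mathrm{co}\,k,\mathrm{ab}\,k,\mathrm{new}\,k\}$ (symmetric rules omitted): - if $P\equiv\mathrm{co}\mid P''$ for some $P''$ and $P\rightsquigarrow_{\mathrm{co}}P'$ then $[\![P\triangleright_kQ]\!]\xrightarrow{\mathrm{co}\,k}P'$; - $[\![P\blacktriangleright Q]\!]\xrightarrow{\mathrm{new}\,k}[\![P\triangleright_kQ]\!]$; - $[\![P\triangleright_kQ]\!]\xrightarrow{\mathrm{ab}\,k}Q$; - for $\beta=\mathrm{co}\,k$ or $\mathrm{ab}\,k$: if $P\xrightarrow{\beta}P'$ and $Q\xrightarrow{\beta}Q'$ then $P\mid Q\xrightarrow{\beta}P'\mid Q'$; - if $P\xrightarrow{\beta}P'$ and $\beta\,\sharp\,Q$ then $P\mid Q\xrightarrow{\beta}P'\mid Q$; - if $P\xrightarrow{\beta}P'$ then $\nu a.P\xrightarrow{\beta}\nu a.P'$. Here $\equiv$ is standard CCS structural equivalence extended to transactions, and $\rightsquigarrow_{\mathrm{co}}$ is given by: $\mathrm{co}\rightsquigarrow_{\mathrm{co}}\mathbf 0$; sums, variables, $\mathrm{rec}X.P$ and $[\![P\blacktriangleright Q]\!]$ are related to themselves; it is compatible with $\nu a.-$ and $-\mid-$. EXTENDED CONFIGURATIONS. $I$ is a countable index set. An extended configuration is $\langle E;H\bullet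 P\rangle$ with $P$ a process, $E$ an equivalence relation over a finite subset of $\mathsf{TrN}$, and $H$ a finite partial function from $I$ to $\{k(a),k(\mathrm{ab}),k(\mathrm{co})\mid k\in\mathsf{exTrN},a\in\mathsf{Act}\}$. Let $H^{\mathrm{trn}}(i)$ be the name used in $H(i)$, $H^{\mathrm{trn}}$ the set of all these, and $\mathrm{Hasco}(H)=\{k\mid\exists i.\,H(i)=k(\mathrm{co})\}$. It is required that: (i) $H^{\mathrm{trn}}(i)=H^{\mathrm{trn}}(j)$ implies $i=j$; (ii) for $k\in\mathsf{exTrN}$, $k\,E\,k$ iff $k\in H^{\mathrm{trn}}$, and $k\,E\,k'$ implies ($k\in\mathrm{Hasco}(H)$ iff $k'\in\mathrm{Hasco}(H)$); (iii) $ftn(P)\cap\mathrm{Hasco}(H)=\emptyset$; (iv) $k\,E\,k'$ and $k,k'\in ftn(P)$ imply $k=k'$. Convention: external names of a configuration are those in its history, i.e. $ftn(P)\cap\mathsf{exTrN}\subseteq H^{\mathrm{trn}}$; in particular a process $P$ viewed as $\langle\emptyset;\varepsilon\bullet P\rangle$ ($\varepsilon$ the empty history) has $ftn(P)\subseteq\mathsf{inTrN}$. "$H,k(a)$" denotes $H$ extended at a new index. For $\sigma=\tilde k\mapsto l$, $\sigma(E)$ is the smallest equivalence relation $F\supseteq E$ with $l\,F\,l$ and $k\,F\,l$ for all $k\in dom(\sigma)$. $(E;H)\setminus_{\mathrm{co}}k$ (resp. $\setminus_{\mathrm{ab}}k$) keeps $E$ and, for every $k'\,E\,k$, changes each $k'(a)$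 in $H$ to $k'(\mathrm{co})$ (resp. $k'(\mathrm{ab})$). With $\Delta=E;H$, the extended transitions between extended configurations are: - $\langle\Delta\bullet P\rangle\xrightarrow{\tau}_e\langle\Delta\bullet Q\rangle$ if $P\xrightarrow{\tau}_\varepsilon Q$; - $\xrightarrow{\tau}_e\langle\sigma(E);H\bullet Q\rangle$ if $P\xrightarrow{k(\tau)}_\sigma Q$, $k\,\sharp\,E,H$, $k\in\mathsf{inTrN}$; - $\xrightarrow{\tau}_e\langle\Delta\bullet Q\rangle$ if $P\xrightarrow{\mathrm{new}\,k}Q$, $k\,\sharp\,\Delta$, $k\in\mathsf{inTrN}$; - $\xrightarrow{\tau}_e\langle\Delta\setminus_{\mathrm{co}}k\bullet Q\rangle$ if $P\xrightarrow{\mathrm{co}\,k}Q$; - $\xrightarrow{\tau}_e\langle\Delta\setminus_{\mathrm{ab}}k\bullet Q\rangle$ if $P\xrightarrow{\mathrm{ab}\,k}Q$; - $\xrightarrow{k(a)}_e\langle\sigma(E);H,k(a)\bullet Q\rangle$ if $P\xrightarrow{k(a)}_\sigma Q$, $k\,\sharp\,E,H$, $k\in\mathsf{exTrN}$; - $\xrightarrow{k(a)}_e\langle E,(k,k);H,k(\mathrm{ab})\bullet P\rangle$ if $k\,\sharp\,E,H,P$, $k\in\mathsf{exTrN}$. The commit-sensitive transitions $\xrightarrow{\zeta}_c$ are given by the same rules (with $_c$ for $_e$), except that the commit rule is replaced, with $E_{ext}(k)=\{k'\in\mathsf{exTrN}\mid k\,E\,k'\}$, by: $\langle\Delta\bullet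 P\rangle\xrightarrow{\mathrm{co}(E_{ext}(k))}_c\langle\Delta\setminus_{\mathrm{co}}k\bullet Q\rangle$ if $P\xrightarrow{\mathrm{co}\,k}Q$ and $E_{ext}(k)\neq\emptyset$; and $\langle\Delta\bullet P\rangle\xrightarrow{\tau}_c\langle\Delta\setminus_{\mathrm{co}}k\bullet Q\rangle$ if $P\xrightarrow{\mathrm{co}\,k}Q$ and $E_{ext}(k)=\emptyset$. For $s\in\{e,c\}$, $\stackrel{\tau}{\Rightarrow}_s$ is $(\xrightarrow{\tau}_s)^*$ and $\stackrel{\zeta}{\Rightarrow}_s$ is $\stackrel{\tau}{\Rightarrow}_s\xrightarrow{\zeta}_s\stackrel{\tau}{\Rightarrow}_s$ otherwise. LOGICS. $\mathsf{Var}$ is a countable set of variables disjoint from $\mathsf{exTrN}$. All three logics have formulae $\langle\tau\rangle\phi$, $\langle x(a)\rangle\phi$ ($x\in\mathsf{Var}$, bound in $\phi$; $a\in\mathsf{Act}$), $\neg\phi$, $\bigwedge_{i\in M}\phi_i$ ($M$ an arbitrary index set), plus: in $\mathcal L_{\mathsf{Hasco}}$, $\mathtt{Hasco}(v)$; in $\mathcal L_{\mathsf{Eq}}$, $v_1=_{\mathrm{co}}v_2$; in $\mathcal L_{\mathsf{Canco}}$, $\langle\mathrm{co}(K)\rangle\phi$ with $\emptyset\neq K\subseteq\mathsf{exTrN}\uplus\mathsf{Var}$; here $v,v_1,v_2\in\mathsf{exTrN}\cup\mathsf{Var}$. Closed formulae have no free variables. Satisfaction of closed formulae by extended configurations, with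 $s=e$ for $\mathcal L_{\mathsf{Hasco}},\mathcal L_{\mathsf{Eq}}$ and $s=c$ for $\mathcal L_{\mathsf{Canco}}$: $\mathcal C\models\langle\tau\rangle\phi$ iff $\mathcal C\stackrel{\tau}{\Rightarrow}_s\mathcal C'\models\phi$ for some $\mathcal C'$; $\mathcal C\models\langle x(a)\rangle\phi$ iff there is a cofinite $N\subseteq\mathsf{exTrN}$ such that for all $l\in N$ there is $\mathcal C'$ with $\mathcal C\stackrel{l(a)}{\Rightarrow}_s\mathcal C'$ and $\mathcal C'\models\phi[l/x]$; conjunction and negation are standard; and, for $\mathcal C=\langle E;H\bullet P\rangle$: $\mathcal C\models\mathtt{Hasco}(k)$ iff $k\in\mathrm{Hasco}(H)$; $\mathcal C\models k=_{\mathrm{co}}k'$ iff $k,k'\in\mathrm{Hasco}(H)$ and $k\,E\,k'$; $\mathcal C\models\langle\mathrm{co}(K)\rangle\phi$ iff $\mathcal C\stackrel{\mathrm{co}(K)}{\Rightarrow}_c\mathcal C'\models\phi$ for some $\mathcal C'$. For a logic $\mathcal L$ and process $P$, $\mathcal L(P)$ is the set of closed formulae of $\mathcal L$ satisfied by $\langle\emptyset;\varepsilon\bullet P\rangle$.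
   Formalization: Condition (4) on dormant transactions is required of the compared processes P, Q but not of processes in reached configurations, since unfolding rec X.(a.X | [[P▶Q]]) puts a dormant transaction under a prefix and so violates (4). -}

module Defs where

open import Level using (0ℓ)
open import Data.Nat using (ℕ; zero; suc)
open import Data.Fin using (Fin; zero; suc; lift)
open import Data.List using (List; []; _∷_; [_]; _++_; map)
open import Data.List.Membership.Propositional using (_∈_; _∉_)
import Data.List.Membership.DecPropositional as DecMembership
open import Data.Product using (Σ; ∃₂; ∃-syntax; _×_; _,_)
import Data.Product.Properties as ×
open import Data.Sum using (_⊎_; inj₁; inj₂)
import Data.Sum.Properties as ⊎
open import Function using (_∘_)
open import Function.Bundles using (_↣_; _↔_; _⇔_; mk⇔; Inverse)
open import Relation.Binary.Construct.Closure.ReflexiveTransitive using (Star)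
open import Relation.Binary.Definitions using (DecidableEquality)
open import Relation.Binary.PropositionalEquality using (_≡_; _≢_; refl)
open import Relation.Nullary using (¬_; yes; no; contradiction)
open import Relation.Unary using (Pred; Satisfiable; _≐_)

-- The sets of names left abstract by the calculus.  All are infinite; decidable
-- equality is no restriction classically, and lets substitutions compute.
record Signature : Set₁ where
  field
    Chan inTrN exTrN   : Set
    _≟ᶜ_               : DecidableEquality Chan
    _≟ⁱ_               : DecidableEquality inTrN
    _≟ᵉ_               : DecidableEquality exTrN
    Chan-infinite      : ℕ ↣ Chan
    inTrN-infinite     : ℕ ↣ inTrN
    exTrN-infinite     : ℕ ↣ exTrN

module TCCS (S : Signature) where
  open Signature S

  TrN : Set
  TrN = inTrN ⊎ exTrN

  _≟ᵗ_ : DecidableEquality TrN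
  _≟ᵗ_ = ⊎.≡-dec _≟ⁱ_ _≟ᵉ_

  open DecMembership _≟ᵗ_ using () renaming (_∈?_ to _∈ᵗ?_)
  open DecMembership (×.≡-dec _≟ᵗ_ _≟ᵗ_) using () renaming (_∈?_ to _∈ᵖ?_)

  -- Restriction and recursion are represented by de Bruijn indices, so that
  -- terms are taken up to α-conversion: `Term m n` has `m` restricted channels
  -- and `n` process variables in scope.  Unrestricted channels are names.

  data Action (m : ℕ) : Set where
    name coname : Chan ⊎ Fin m → Action m

  Act : Set
  Act = Action 0

  bar : ∀ {m} → Action m → Action m
  bar (name c)   = coname c
  bar (coname c) = name c

  data Prefix (m : ℕ) : Set where
    τ   : Prefix m
    act : Action m → Prefix m

  -- Up to bijection, the countable index sets.
  data Size : Set where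
    fin : ℕ → Size
    ω   : Size

  Ix : Size → Set
  Ix (fin n) = Fin n
  Ix ω       = ℕ

  infixr 6 _∣_

  -- The left-hand sides of transactions have no process variables in scope:
  -- this is the requirement that they are closed.
  data Term (m : ℕ) : ℕ → Set

  data Term m where
    ∑        : ∀ {n} (J : Size) → (Ix J → Prefix m) → (Ix J → Term m n) → Term m n
    _∣_      : ∀ {n} → Term m n → Term m n → Term m n
    ν        : ∀ {n} → Term (suc m) n → Term m n
    var      : ∀ {n} → Fin n → Term m n
    rec      : ∀ {n} → Term m (suc n) → Term m n
    ⟦_▷[_]_⟧ : ∀ {n} → Term m 0 → TrN → Term m n → Term m n
    co       : ∀ {n} → Term m n
    ⟦_▶_⟧    : ∀ {n} → Term m 0 → Term m n → Term m n

  𝟎 : ∀ {m n} → Term m n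
  𝟎 = ∑ (fin 0) (λ ()) (λ ())

  renameChan : ∀ {m m′} → (Fin m → Fin m′) → Chan ⊎ Fin m → Chan ⊎ Fin m′
  renameChan ρ (inj₁ c) = inj₁ c
  renameChan ρ (inj₂ i) = inj₂ (ρ i)

  renameAct : ∀ {m m′} → (Fin m → Fin m′) → Action m → Action m′
  renameAct ρ (name c)   = name (renameChan ρ c)
  renameAct ρ (coname c) = coname (renameChan ρ c)

  renamePrefix : ∀ {m m′} → (Fin m → Fin m′) → Prefix m → Prefix m′
  renamePrefix ρ τ       = τ
  renamePrefix ρ (act a) = act (renameAct ρ a)

  renameC : ∀ {m m′ n} → (Fin m → Fin m′) → Term m n → Term m′ n
  renameC ρ (∑ J μ P)      = ∑ J (renamePrefix ρ ∘ μ) (λ i → renameC ρ (P i))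
  renameC ρ (P ∣ Q)        = renameC ρ P ∣ renameC ρ Q
  renameC ρ (ν P)          = ν (renameC (lift 1 ρ) P)
  renameC ρ (var X)        = var X
  renameC ρ (rec P)        = rec (renameC ρ P)
  renameC ρ ⟦ P ▷[ k ] Q ⟧ = ⟦ renameC ρ P ▷[ k ] renameC ρ Q ⟧
  renameC ρ co             = co
  renameC ρ ⟦ P ▶ Q ⟧      = ⟦ renameC ρ P ▶ renameC ρ Q ⟧

  renameV : ∀ {m n n′} → (Fin n → Fin n′) → Term m n → Term m n′
  renameV ρ (∑ J μ P)      = ∑ J μ (λ i → renameV ρ (P i))
  renameV ρ (P ∣ Q)        = renameV ρ P ∣ renameV ρ Q
  renameV ρ (ν P)          = ν (renameV ρ P)
  renameV ρ (var X)        = var (ρ X)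
  renameV ρ (rec P)        = rec (renameV (lift 1 ρ) P)
  renameV ρ ⟦ P ▷[ k ] Q ⟧ = ⟦ P ▷[ k ] renameV ρ Q ⟧
  renameV ρ co             = co
  renameV ρ ⟦ P ▶ Q ⟧      = ⟦ P ▶ renameV ρ Q ⟧

  liftSub : ∀ {m n n′} → (Fin n → Term m n′) → Fin (suc n) → Term m (suc n′)
  liftSub θ zero    = var zero
  liftSub θ (suc X) = renameV suc (θ X)

  sub : ∀ {m n n′} → (Fin n → Term m n′) → Term m n → Term m n′
  sub θ (∑ J μ P)      = ∑ J μ (λ i → sub θ (P i))
  sub θ (P ∣ Q)        = sub θ P ∣ sub θ Q
  sub θ (ν P)          = ν (sub (renameC suc ∘ θ) P)
  sub θ (var X)        = θ X
  sub θ (rec P)        = rec (sub (liftSub θ) P)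
  sub θ ⟦ P ▷[ k ] Q ⟧ = ⟦ P ▷[ k ] sub θ Q ⟧
  sub θ co             = co
  sub θ ⟦ P ▶ Q ⟧      = ⟦ P ▶ sub θ Q ⟧

  _[_/X] : ∀ {m n} → Term m (suc n) → Term m n → Term m n
  _[_/X] {m} {n} P R = sub θ P
    where
    θ : Fin (suc n) → Term m n
    θ zero    = R
    θ (suc X) = var X

  infix 4 _⊑_ _∈ftn_ _♯_

  data _⊑_ {m n : ℕ} (T : Term m n) : ∀ {m′ n′} → Term m′ n′ → Set where
    here  : T ⊑ T
    sum   : ∀ {m′ n′ J μ} {P : Ix J → Term m′ n′} (i : Ix J) → T ⊑ P i → T ⊑ ∑ J μ P
    parˡ  : ∀ {m′ n′} {P Q : Term m′ n′} → T ⊑ P → T ⊑ P ∣ Q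
    parʳ  : ∀ {m′ n′} {P Q : Term m′ n′} → T ⊑ Q → T ⊑ P ∣ Q
    res   : ∀ {m′ n′} {P : Term (suc m′) n′} → T ⊑ P → T ⊑ ν P
    rec   : ∀ {m′ n′} {P : Term m′ (suc n′)} → T ⊑ P → T ⊑ rec P
    runˡ  : ∀ {m′ n′ P k} {Q : Term m′ n′} → T ⊑ P → T ⊑ ⟦ P ▷[ k ] Q ⟧
    runʳ  : ∀ {m′ n′ P k} {Q : Term m′ n′} → T ⊑ Q → T ⊑ ⟦ P ▷[ k ] Q ⟧
    dormˡ : ∀ {m′ n′ P} {Q : Term m′ n′} → T ⊑ P → T ⊑ ⟦ P ▶ Q ⟧
    dormʳ : ∀ {m′ n′ P} {Q : Term m′ n′} → T ⊑ Q → T ⊑ ⟦ P ▶ Q ⟧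

  _∈ftn_ : ∀ {m n} → TrN → Term m n → Set
  k ∈ftn T = ∃[ m′ ] ∃[ n′ ] Σ (Term m′ 0) λ P → Σ (Term m′ n′) λ Q → ⟦ P ▷[ k ] Q ⟧ ⊑ T

  _♯_ : ∀ {m n} → TrN → Term m n → Set
  k ♯ T = ¬ (k ∈ftn T)

  NameFree : ∀ {m n} → Term m n → Set
  NameFree T = ∀ k → k ♯ T

  NoDormant : ∀ {m n} → Term m n → Set
  NoDormant T = ∀ {m′ n′} {P : Term m′ 0} {Q : Term m′ n′} → ¬ (⟦ P ▶ Q ⟧ ⊑ T)

  record WellNamed {m n} (T : Term m n) : Set where
    field
      ftn-finite : ∃[ ks ] (∀ k → k ∈ftn T → k ∈ ks)
      running : ∀ {m′ n′ k} {P : Term m′ 0} {Q : Term m′ n′} →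
                ⟦ P ▷[ k ] Q ⟧ ⊑ T → NameFree P × NameFree Q
      dormant : ∀ {m′ n′} {P : Term m′ 0} {Q : Term m′ n′} →
                ⟦ P ▶ Q ⟧ ⊑ T → NameFree P × NameFree Q
      sums    : ∀ {m′ n′ J μ} {P : Ix J → Term m′ n′} →
                ∑ J μ P ⊑ T → ∀ i → NameFree (P i)
      recs    : ∀ {m′ n′} {P : Term m′ (suc n′)} → rec P ⊑ T → NameFree P

  record DormantGuarded {m n} (T : Term m n) : Set where
    field
      running : ∀ {m′ n′ k} {P : Term m′ 0} {Q : Term m′ n′} →
                ⟦ P ▷[ k ] Q ⟧ ⊑ T → NoDormant P
      dormant : ∀ {m′ n′} {P : Term m′ 0} {Q : Term m′ n′} →
                ⟦ P ▶ Q ⟧ ⊑ T → NoDormant P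
      sums    : ∀ {m′ n′ J μ} {P : Ix J → Term m′ n′} →
                ∑ J μ P ⊑ T → ∀ i → NoDormant (P i)

  record Process : Set where
    field
      term           : Term 0 0
      wellNamed      : WellNamed term
      dormantGuarded : DormantGuarded term

  swap : ∀ {m} → Fin (suc (suc m)) → Fin (suc (suc m))
  swap zero          = suc zero
  swap (suc zero)    = zero
  swap (suc (suc i)) = suc (suc i)

  infix 4 _≡ₛ_ _⇝co_

  -- α-conversion is built into the representation of terms; `sum` both is the
  -- congruence rule and lets summands be rearranged.
  data _≡ₛ_ {m n : ℕ} : Term m n → Term m n → Set where
    reflₛ     : ∀ {P} → P ≡ₛ P
    symₛ      : ∀ {P Q} → P ≡ₛ Q → Q ≡ₛ P
    transₛ    : ∀ {P Q R} → P ≡ₛ Q → Q ≡ₛ R → P ≡ₛ R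
    par-unit  : ∀ {P} → P ∣ 𝟎 ≡ₛ P
    par-comm  : ∀ {P Q} → P ∣ Q ≡ₛ Q ∣ P
    par-assoc : ∀ {P Q R} → (P ∣ Q) ∣ R ≡ₛ P ∣ (Q ∣ R)
    res-nil   : ν 𝟎 ≡ₛ 𝟎
    res-swap  : ∀ {P} → ν (ν P) ≡ₛ ν (ν (renameC swap P))
    res-par   : ∀ {P Q} → ν P ∣ Q ≡ₛ ν (P ∣ renameC suc Q)
    sum       : ∀ {J J′ μ μ′} {P : Ix J → Term m n} {P′ : Ix J′ → Term m n}
                (f : Ix J ↔ Ix J′) →
                (∀ i → μ i ≡ μ′ (Inverse.to f i)) →
                (∀ i → P i ≡ₛ P′ (Inverse.to f i)) → ∑ J μ P ≡ₛ ∑ J′ μ′ P′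
    par       : ∀ {P P′ Q Q′} → P ≡ₛ P′ → Q ≡ₛ Q′ → P ∣ Q ≡ₛ P′ ∣ Q′
    res       : ∀ {P P′} → P ≡ₛ P′ → ν P ≡ₛ ν P′
    rec       : ∀ {P P′} → P ≡ₛ P′ → rec P ≡ₛ rec P′
    run       : ∀ {P P′ k Q Q′} → P ≡ₛ P′ → Q ≡ₛ Q′ →
                ⟦ P ▷[ k ] Q ⟧ ≡ₛ ⟦ P′ ▷[ k ] Q′ ⟧
    dorm      : ∀ {P P′ Q Q′} → P ≡ₛ P′ → Q ≡ₛ Q′ → ⟦ P ▶ Q ⟧ ≡ₛ ⟦ P′ ▶ Q′ ⟧

  data _⇝co_ {m n : ℕ} : Term m n → Term m n → Set where
    co   : co ⇝co 𝟎
    sum  : ∀ {J μ P} → ∑ J μ P ⇝co ∑ J μ P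
    var  : ∀ {X} → var X ⇝co var X
    rec  : ∀ {P} → rec P ⇝co rec P
    dorm : ∀ {P Q} → ⟦ P ▶ Q ⟧ ⇝co ⟦ P ▶ Q ⟧
    res  : ∀ {P P′} → P ⇝co P′ → ν P ⇝co ν P′
    par  : ∀ {P P′ Q Q′} → P ⇝co P′ → Q ⇝co Q′ → P ∣ Q ⇝co P′ ∣ Q′

  data Subst : Set where
    ε   : Subst
    _↦_ : List TrN → TrN → Subst

  dom range : Subst → List TrN
  dom ε          = []
  dom (ks ↦ l)   = ks
  range ε        = []
  range (ks ↦ l) = [ l ]

  apply : Subst → TrN → TrN
  apply ε        k = k
  apply (ks ↦ l) k with k ∈ᵗ? ks
  ... | yes _ = l
  ... | no  _ = k

  -- By well-formedness sums, recursions and the components of transactions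
  -- contain no transaction names, so only the outermost running transactions
  -- are affected by a substitution.
  _⟨_⟩ : ∀ {m n} → Term m n → Subst → Term m n
  ∑ J μ P      ⟨ σ ⟩ = ∑ J μ P
  (P ∣ Q)      ⟨ σ ⟩ = P ⟨ σ ⟩ ∣ Q ⟨ σ ⟩
  ν P          ⟨ σ ⟩ = ν (P ⟨ σ ⟩)
  var X        ⟨ σ ⟩ = var X
  rec P        ⟨ σ ⟩ = rec P
  ⟦ P ▷[ k ] Q ⟧ ⟨ σ ⟩ = ⟦ P ▷[ apply σ k ] Q ⟧
  co           ⟨ σ ⟩ = co
  ⟦ P ▶ Q ⟧    ⟨ σ ⟩ = ⟦ P ▶ Q ⟧

  data Label (m : ℕ) : Set where
    plain : Prefix m → Label m
    _⦅_⦆  : TrN → Prefix m → Label m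

  weaken : ∀ {m} → Label m → Label (suc m)
  weaken (plain μ) = plain (renamePrefix suc μ)
  weaken (k ⦅ μ ⦆) = k ⦅ renamePrefix suc μ ⦆

  infix 4 _—[_,_]→_ _—[_]→ʳ_

  data _—[_,_]→_ {m : ℕ} : Term m 0 → Label m → Subst → Term m 0 → Set where
    sum  : ∀ {J μ P} (j : Ix J) → ∑ J μ P —[ plain (μ j) , ε ]→ P j
    com  : ∀ {P P′ Q Q′ a} →
           P —[ plain (act a) , ε ]→ P′ → Q —[ plain (act (bar a)) , ε ]→ Q′ →
           P ∣ Q —[ plain τ , ε ]→ P′ ∣ Q′
    rec  : ∀ {P} → rec P —[ plain τ , ε ]→ P [ rec P /X]
    tsum : ∀ {J μ P k a} (j : Ix J) → μ j ≡ act a →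
           ∑ J μ P —[ k ⦅ act a ⦆ , [] ↦ k ]→ ⟦ P j ∣ co ▷[ k ] ∑ J μ P ⟧
    trun : ∀ {P P′ Q k l μ} → P —[ plain μ , ε ]→ P′ → k ≢ l →
           ⟦ P ▷[ l ] Q ⟧ —[ k ⦅ μ ⦆ , [ l ] ↦ k ]→ ⟦ P′ ▷[ k ] Q ⟧
    tcom : ∀ {P P′ Q Q′ k a ls₁ ls₂} →
           P —[ k ⦅ act a ⦆ , ls₁ ↦ k ]→ P′ → Q —[ k ⦅ act (bar a) ⦆ , ls₂ ↦ k ]→ Q′ →
           P ∣ Q —[ k ⦅ τ ⦆ , (ls₁ ++ ls₂) ↦ k ]→ P′ ⟨ ls₂ ↦ k ⟩ ∣ Q′ ⟨ ls₁ ↦ k ⟩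
    parˡ : ∀ {P P′ Q α σ} → P —[ α , σ ]→ P′ → (∀ {k} → k ∈ range σ → k ♯ Q) →
           P ∣ Q —[ α , σ ]→ P′ ∣ Q ⟨ σ ⟩
    parʳ : ∀ {P Q Q′ α σ} → Q —[ α , σ ]→ Q′ → (∀ {k} → k ∈ range σ → k ♯ P) →
           P ∣ Q —[ α , σ ]→ P ⟨ σ ⟩ ∣ Q′
    -- The label under the restriction is a weakened one, that is, the
    -- restricted channel does not occur in it.
    res  : ∀ {P P′ α σ} → P —[ weaken α , σ ]→ P′ → ν P —[ α , σ ]→ ν P′

  data Reconf : Set where
    co ab new : TrN → Reconf

  trn : Reconf → TrN
  trn (co k)  = k
  trn (ab k)  = k
  trn (new k) = k

  data _—[_]→ʳ_ {m : ℕ} : Term m 0 → Reconf → Term m 0 → Set where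
    commit : ∀ {P P′ P″ Q k} → P ≡ₛ co ∣ P″ → P ⇝co P′ →
             ⟦ P ▷[ k ] Q ⟧ —[ co k ]→ʳ P′
    start  : ∀ {P Q k} → ⟦ P ▶ Q ⟧ —[ new k ]→ʳ ⟦ P ▷[ k ] Q ⟧
    abort  : ∀ {P Q k} → ⟦ P ▷[ k ] Q ⟧ —[ ab k ]→ʳ Q
    parco  : ∀ {P P′ Q Q′ k} → P —[ co k ]→ʳ P′ → Q —[ co k ]→ʳ Q′ →
             P ∣ Q —[ co k ]→ʳ P′ ∣ Q′
    parab  : ∀ {P P′ Q Q′ k} → P —[ ab k ]→ʳ P′ → Q —[ ab k ]→ʳ Q′ →
             P ∣ Q —[ ab k ]→ʳ P′ ∣ Q′
    parˡ   : ∀ {P P′ Q β} → P —[ β ]→ʳ P′ → trn β ♯ Q → P ∣ Q —[ β ]→ʳ P′ ∣ Q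
    parʳ   : ∀ {P Q Q′ β} → Q —[ β ]→ʳ Q′ → trn β ♯ P → P ∣ Q —[ β ]→ʳ P ∣ Q′
    res    : ∀ {P P′ β} → P —[ β ]→ʳ P′ → ν P —[ β ]→ʳ ν P′

  -- Finite relations and finite partial functions are given by their graphs.
  -- The countably infinite index set of histories is ℕ.

  Eqv : Set
  Eqv = List (TrN × TrN)

  data Status : Set where
    act   : Act → Status
    ab co : Status

  Hist : Set
  Hist = List (ℕ × exTrN × Status)

  _∈Htrn_ _∈Hasco_ : exTrN → Hist → Set
  k ∈Htrn H  = ∃₂ λ i s → (i , k , s) ∈ H
  k ∈Hasco H = ∃[ i ] (i , k , co) ∈ H

  record RawConfig : Set where
    constructor ⟨_⨾_∙_⟩
    field
      eqv  : Eqv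
      hist : Hist
      proc : Term 0 0

  -- `WellNamed` together with the scoping of `Term` is every condition on
  -- processes but the one on dormant transactions.  That one is not preserved
  -- by unfolding: in rec X.(a.X ∣ ⟦ P ▶ Q ⟧) it moves the dormant transaction
  -- under a prefix.  It is imposed on the processes being compared (`Process`),
  -- not on the configurations they reach.
  record IsConfig (C : RawConfig) : Set where
    open RawConfig C renaming (eqv to E; hist to H; proc to P)
    field
      wellNamed  : WellNamed P
      E-sym      : ∀ {k l} → (k , l) ∈ E → (l , k) ∈ E
      E-trans    : ∀ {k l m} → (k , l) ∈ E → (l , m) ∈ E → (k , m) ∈ E
      H-function : ∀ {i e e′} → (i , e) ∈ H → (i , e′) ∈ H → e ≡ e′
      H-unique   : ∀ {i j k s s′} → (i , k , s) ∈ H → (j , k , s′) ∈ H → i ≡ j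
      E-external : ∀ k → (inj₂ k , inj₂ k) ∈ E ⇔ k ∈Htrn H
      E-hasco    : ∀ {k k′} → (inj₂ k , inj₂ k′) ∈ E → k ∈Hasco H ⇔ k′ ∈Hasco H
      P-hasco    : ∀ {k} → inj₂ k ∈ftn P → ¬ (k ∈Hasco H)
      P-distinct : ∀ {k k′} → (k , k′) ∈ E → k ∈ftn P → k′ ∈ftn P → k ≡ k′
      P-external : ∀ {k} → inj₂ k ∈ftn P → k ∈Htrn H

  record Config : Set where
    constructor config
    field
      raw   : RawConfig
      valid : IsConfig raw
    open RawConfig raw public

  record Fresh (k : TrN) (E : Eqv) (H : Hist) : Set where
    field
      E-freshˡ : ∀ {l} → (k , l) ∉ E
      E-freshʳ : ∀ {l} → (l , k) ∉ E
      H-fresh  : ∀ {k′} → k ≡ inj₂ k′ → ¬ (k′ ∈Htrn H)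

  record ClosedUnder (σ : Subst) (E F : Eqv) : Set where
    field
      sym     : ∀ {k l} → (k , l) ∈ F → (l , k) ∈ F
      trans   : ∀ {k l m} → (k , l) ∈ F → (l , m) ∈ F → (k , m) ∈ F
      extends : ∀ {k l} → (k , l) ∈ E → (k , l) ∈ F
      target  : ∀ {l} → l ∈ range σ → (l , l) ∈ F
      merges  : ∀ {k l} → k ∈ dom σ → l ∈ range σ → (k , l) ∈ F

  -- F is (the graph of) σ(E).
  _⟪_⟫=_ : Subst → Eqv → Eqv → Set
  σ ⟪ E ⟫= F = ClosedUnder σ E F ×
               (∀ F′ → ClosedUnder σ E F′ → ∀ {k l} → (k , l) ∈ F → (k , l) ∈ F′)

  resolve : Status → Status → Status
  resolve s (act a) = s
  resolve s ab      = ab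
  resolve s co      = co

  -- `settle co` and `settle ab` give the history components of (E;H)∖co k and
  -- (E;H)∖ab k.
  settle : Status → Eqv → TrN → Hist → Hist
  settle s E k = map settle₁
    where
    settle₁ : ℕ × exTrN × Status → ℕ × exTrN × Status
    settle₁ (i , k′ , s′) with (inj₂ k′ , k) ∈ᵖ? E
    ... | yes _ = i , k′ , resolve s s′
    ... | no  _ = i , k′ , s′

  -- K lists E_ext(k).
  _Lists_ext_ : List exTrN → Eqv → TrN → Set
  K Lists E ext k = ∀ k′ → k′ ∈ K ⇔ (k , inj₂ k′) ∈ E

  data ExtLabel : Set where
    τ    : ExtLabel
    _⦅_⦆ : exTrN → Act → ExtLabel
    co   : List exTrN → ExtLabel

  data Semantics : Set where
    extended commit-sensitive : Semantics

  data Step : Semantics → RawConfig → ExtLabel → RawConfig → Set where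
    tau     : ∀ {s E H P Q} → P —[ plain τ , ε ]→ Q →
              Step s ⟨ E ⨾ H ∙ P ⟩ τ ⟨ E ⨾ H ∙ Q ⟩
    ktau    : ∀ {s E F H P Q k σ} → P —[ inj₁ k ⦅ τ ⦆ , σ ]→ Q → Fresh (inj₁ k) E H →
              σ ⟪ E ⟫= F → Step s ⟨ E ⨾ H ∙ P ⟩ τ ⟨ F ⨾ H ∙ Q ⟩
    start   : ∀ {s E H P Q k} → P —[ new (inj₁ k) ]→ʳ Q → Fresh (inj₁ k) E H →
              Step s ⟨ E ⨾ H ∙ P ⟩ τ ⟨ E ⨾ H ∙ Q ⟩
    commit  : ∀ {E H P Q k} → P —[ co k ]→ʳ Q →
              Step extended ⟨ E ⨾ H ∙ P ⟩ τ ⟨ E ⨾ settle co E k H ∙ Q ⟩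
    commitᵉ : ∀ {E H P Q k K} → P —[ co k ]→ʳ Q → K Lists E ext k → K ≢ [] →
              Step commit-sensitive ⟨ E ⨾ H ∙ P ⟩ (co K) ⟨ E ⨾ settle co E k H ∙ Q ⟩
    commitⁱ : ∀ {E H P Q k} → P —[ co k ]→ʳ Q → [] Lists E ext k →
              Step commit-sensitive ⟨ E ⨾ H ∙ P ⟩ τ ⟨ E ⨾ settle co E k H ∙ Q ⟩
    abort   : ∀ {s E H P Q k} → P —[ ab k ]→ʳ Q →
              Step s ⟨ E ⨾ H ∙ P ⟩ τ ⟨ E ⨾ settle ab E k H ∙ Q ⟩
    kact    : ∀ {s E F H P Q k a σ i} → P —[ inj₂ k ⦅ act a ⦆ , σ ]→ Q →
              Fresh (inj₂ k) E H → σ ⟪ E ⟫= F → (∀ {e} → (i , e) ∉ H) →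
              Step s ⟨ E ⨾ H ∙ P ⟩ (k ⦅ a ⦆) ⟨ F ⨾ (i , k , act a) ∷ H ∙ Q ⟩
    kabort  : ∀ {s E H P k a i} →
              Fresh (inj₂ k) E H → inj₂ k ♯ P → (∀ {e} → (i , e) ∉ H) →
              Step s ⟨ E ⨾ H ∙ P ⟩ (k ⦅ a ⦆)
                     ⟨ (inj₂ k , inj₂ k) ∷ E ⨾ (i , k , ab) ∷ H ∙ P ⟩

  _—[_∣_]→_ : Config → Semantics → ExtLabel → Config → Set
  C —[ s ∣ ζ ]→ C′ = Step s (Config.raw C) ζ (Config.raw C′)

  _=[_∣τ]⇒_ : Config → Semantics → Config → Set
  C =[ s ∣τ]⇒ C′ = Star (λ D D′ → D —[ s ∣ τ ]→ D′) C C′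

  -- Used for ζ other than τ only.
  _=[_∣_]⇒_ : Config → Semantics → ExtLabel → Config → Set
  C =[ s ∣ ζ ]⇒ C′ = ∃₂ λ D D′ → C =[ s ∣τ]⇒ D × D —[ s ∣ ζ ]→ D′ × D′ =[ s ∣τ]⇒ C′

  data Logic : Set where
    ℒHasco ℒEq ℒCanco : Logic

  semantics : Logic → Semantics
  semantics ℒHasco = extended
  semantics ℒEq    = extended
  semantics ℒCanco = commit-sensitive

  -- Formula variables are de Bruijn indices.
  Ref : ℕ → Set
  Ref n = exTrN ⊎ Fin n

  -- `Formula ℒ n` has its free variables among `n`; closed formulae are
  -- `Formula ℒ 0`.
  data Formula : Logic → ℕ → Set₁ where
    ⟨τ⟩_    : ∀ {ℒ n} → Formula ℒ n → Formula ℒ n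
    ⟨x⦅_⦆⟩_ : ∀ {ℒ n} → Act → Formula ℒ (suc n) → Formula ℒ n
    ¬′_     : ∀ {ℒ n} → Formula ℒ n → Formula ℒ n
    ⋀       : ∀ {ℒ n} (M : Set) → (M → Formula ℒ n) → Formula ℒ n
    Hasco   : ∀ {n} → Ref n → Formula ℒHasco n
    _=co_   : ∀ {n} → Ref n → Ref n → Formula ℒEq n
    ⟨co⟩    : ∀ {n} (K : Pred (Ref n) 0ℓ) → Satisfiable K → Formula ℒCanco n → Formula ℒCanco n

  -- Simultaneous substitutions of external names for the free variables.
  Env : ℕ → Set
  Env n = Fin n → exTrN

  _◂_ : ∀ {n} → exTrN → Env n → Env (suc n)
  (l ◂ ρ) zero    = l
  (l ◂ ρ) (suc x) = ρ x

  inst : ∀ {n} → Env n → Ref n → exTrN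
  inst ρ (inj₁ k) = k
  inst ρ (inj₂ x) = ρ x

  -- The image of K under a substitution.
  instSet : ∀ {n} → Env n → Pred (Ref n) 0ℓ → Pred exTrN 0ℓ
  instSet ρ K k = ∃[ v ] K v × inst ρ v ≡ k

  -- `Sat C φ ρ` is satisfaction by C of the closed formula φρ.  A cofinite set
  -- of names is given by the list N of the names outside it.
  Sat : ∀ {ℒ n} → Config → Formula ℒ n → Env n → Set
  Sat {ℒ} C (⟨τ⟩ φ)      ρ = ∃[ C′ ] C =[ semantics ℒ ∣τ]⇒ C′ × Sat C′ φ ρ
  Sat {ℒ} C (⟨x⦅ a ⦆⟩ φ) ρ = ∃[ N ] ∀ l → l ∉ N →
                               ∃[ C′ ] C =[ semantics ℒ ∣ l ⦅ a ⦆ ]⇒ C′ × Sat C′ φ (l ◂ ρ)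
  Sat C (¬′ φ)           ρ = ¬ Sat C φ ρ
  Sat C (⋀ M φ)          ρ = (i : M) → Sat C (φ i) ρ
  Sat C (Hasco v)        ρ = inst ρ v ∈Hasco Config.hist C
  Sat C (v₁ =co v₂)      ρ = inst ρ v₁ ∈Hasco Config.hist C × inst ρ v₂ ∈Hasco Config.hist C ×
                             (inj₂ (inst ρ v₁) , inj₂ (inst ρ v₂)) ∈ Config.eqv C
  Sat C (⟨co⟩ K _ φ)     ρ = ∃[ ks ] ((_∈ ks) ≐ instSet ρ K) ×
                             (∃[ C′ ] C =[ commit-sensitive ∣ co ks ]⇒ C′ × Sat C′ φ ρ)

  _⊨_ : ∀ {ℒ} → Config → Formula ℒ 0 → Set
  C ⊨ φ = Sat C φ (λ ())

  -- The convention that external names of a configuration occur in its history,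
  -- for the empty history.
  Internal : Process → Set
  Internal P = ∀ k → inj₂ k ♯ Process.term P

  initial : (P : Process) → Internal P → Config
  initial P int = config ⟨ [] ⨾ [] ∙ term ⟩ record
    { wellNamed  = wellNamed
    ; E-sym      = λ ()
    ; E-trans    = λ ()
    ; H-function = λ ()
    ; H-unique   = λ ()
    ; E-external = λ _ → mk⇔ (λ ()) (λ { (_ , _ , ()) })
    ; E-hasco    = λ ()
    ; P-hasco    = λ { _ (_ , ()) }
    ; P-distinct = λ ()
    ; P-external = λ {k} k∈P → contradiction k∈P (int k)
    }
    where
    open Process P

  _⟦_,_⟧ : (ℒ : Logic) (P : Process) → Internal P → Pred (Formula ℒ 0) 0ℓ
  ℒ ⟦ P , int ⟧ = λ φ → initial P int ⊨ φ

  infix 4 _≼_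

  _≼_ : Logic → Logic → Set₁
  ℒ₁ ≼ ℒ₂ = ∀ P Q (p : Internal P) (q : Internal Q) →
            ℒ₂ ⟦ P , p ⟧ ≐ ℒ₂ ⟦ Q , q ⟧ → ℒ₁ ⟦ P , p ⟧ ≐ ℒ₁ ⟦ Q , q ⟧

{-# OPTIONS --safe #-}
module Submission where

-- Hasco k is k =co k, which gives ℒHasco ≼ ℒEq.  The other two comparisons
-- go through bisimulations.  Formulas without constants, read in environments
-- that name all external names of a history, have the Hennessy–Milner property;
-- the case of ⟨x(a)⟩ holds because any two names not in the history can be
-- exchanged.  So equivalent configurations simulate each other's weak
-- transitions in the semantics of their own logic, and it remains to change the
-- semantics.  The relation =co is determined by the sets K in the labels co(K):
-- committing K adds K × K to it, and no other step changes it.  This gives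
-- ℒEq ≼ ℒCanco.  Conversely, if one side commits K in one step, then K is an
-- equivalence class beforehand, so that from there on its members can only be
-- committed together.  This is visible to Hasco, and hence the other side
-- commits K in one step as well.  This gives ℒCanco ≼ ℒHasco.

open import Defs
open import Axiom.ExcludedMiddle using (ExcludedMiddle)
open import Data.Empty using (⊥; ⊥-elim)
open import Data.Fin using (Fin; zero; suc; lift)
open import Data.List using (List; []; _∷_; [_]; _++_; map; filter; tabulate)
open import Data.List.Properties using (map-++; map-∘; map-id; map-cong; map-id-local)
open import Data.List.Membership.Propositional using (_∈_; _∉_)
import Data.List.Membership.DecPropositional as DecMembership
open import Data.List.Membership.Propositional.Properties
  using (∈-++⁺ˡ; ∈-++⁺ʳ; ∈-++⁻; ∈-map⁺; ∈-map⁻; ∈-filter⁺; ∈-filter⁻; ∈-tabulate⁺; finite)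
import Data.List.Relation.Unary.All as All
open import Data.List.Relation.Unary.Any using (here; there)
open import Data.Nat using (ℕ; suc)
open import Data.Product using (∃₂; ∃-syntax; Σ-syntax; _×_; _,_; proj₁; proj₂)
import Data.Product.Properties as ×
open import Data.Sum using (_⊎_; inj₁; inj₂; [_,_]′)
import Data.Sum as Sum
open import Data.Unit using (⊤; tt)
open import Function using (_∘_; id)
open import Function.Bundles using (_⇔_; mk⇔; Equivalence; Injection)
open import Level using (0ℓ)
open import Relation.Binary.Construct.Closure.ReflexiveTransitive using (ε; _◅_; _◅◅_)
import Relation.Binary.Construct.Closure.ReflexiveTransitive as Star
open import Relation.Binary.PropositionalEquality
  using (_≡_; _≢_; refl; sym; trans; cong; cong₂; subst; subst₂)
open import Relation.Nullary using (¬_; yes; no; contradiction)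
open import Relation.Nullary.Decidable using (decidable-stable)
open import Relation.Unary using (Pred; _≐_)

-- Two obstacles shape the proof. First, an infinitary formula may mention every external name, so
-- it need not have a fresh name to exchange. The equivalence is therefore tested on constant-free
-- formulas only; constants come back at the end, because matching transitions carry literally the
-- same names on both sides. Secondly, `IsConfig` admits a running transaction related to an aborted
-- external name. Its commit would be labelled with that name, although `resolve` leaves the aborted
-- entry as it is, and the label would not show in the history. The invariant `Live` excludes this:
-- it holds vacuously for the empty history and every step preserves it. Under it, a step labelled
-- `co K` makes exactly the members of K newly committed, which is what ties labels to `Hasco` and
-- `=co`. Excluded middle turns failure of equivalence into a separating formula. The conjunction of
-- these ranges over all weak derivatives of the other side, as arbitrary index sets permit.

module Involution {A : Set} (f : A → A) (involutive : ∀ x → f (f x) ≡ x) where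
  injective : ∀ {x y} → f x ≡ f y → x ≡ y
  injective {x} {y} eq = trans (sym (involutive x)) (trans (cong f eq) (involutive y))

  ∈-map⇒ : ∀ {x xs} → x ∈ map f xs → f x ∈ xs
  ∈-map⇒ x∈ with ∈-map⁻ f x∈
  ... | y , y∈ , refl = subst (_∈ _) (sym (involutive y)) y∈

  ∈-map⇐ : ∀ {x xs} → f x ∈ xs → x ∈ map f xs
  ∈-map⇐ {x} fx∈ = subst (_∈ _) (involutive x) (∈-map⁺ f fx∈)

  ∈-map-cancel : ∀ {x xs} → f x ∈ map f xs → x ∈ xs
  ∈-map-cancel {x} fx∈ = subst (_∈ _) (involutive x) (∈-map⇒ fx∈)

  map-involutive : ∀ xs → map f (map f xs) ≡ xs
  map-involutive xs = trans (sym (map-∘ xs)) (trans (map-cong involutive xs) (map-id xs))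

module Comparison (em : ∀ ℓ → ExcludedMiddle ℓ) (S : Signature) where
  open Signature S
  open TCCS S
  open DecMembership _≟ᵗ_ using () renaming (_∈?_ to _∈ᵗ?_)
  open DecMembership (×.≡-dec _≟ᵗ_ _≟ᵗ_) using () renaming (_∈?_ to _∈ᵖ?_)

  -- Transaction names in processes

  -- `Nameless`, `WellPlaced` and `Exposed` restate `NameFree`, `WellNamed` and `_∈ftn_` by
  -- recursion on the term, so that proofs can follow the transition rules instead of quantifying
  -- over subterms.
  Nameless : ∀ {m n} → Term m n → Set
  Nameless (∑ J μ P)      = ∀ i → Nameless (P i)
  Nameless (P ∣ Q)        = Nameless P × Nameless Q
  Nameless (ν P)          = Nameless P
  Nameless (var X)        = ⊤
  Nameless (rec P)        = Nameless P
  Nameless ⟦ P ▷[ k ] Q ⟧ = ⊥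
  Nameless co             = ⊤
  Nameless ⟦ P ▶ Q ⟧      = Nameless P × Nameless Q

  WellPlaced : ∀ {m n} → Term m n → Set
  WellPlaced (∑ J μ P)      = ∀ i → Nameless (P i)
  WellPlaced (P ∣ Q)        = WellPlaced P × WellPlaced Q
  WellPlaced (ν P)          = WellPlaced P
  WellPlaced (var X)        = ⊤
  WellPlaced (rec P)        = Nameless P
  WellPlaced ⟦ P ▷[ k ] Q ⟧ = Nameless P × Nameless Q
  WellPlaced co             = ⊤
  WellPlaced ⟦ P ▶ Q ⟧      = Nameless P × Nameless Q

  -- Only `_∣_` and `ν` are searched, since in a well-placed term nothing else can stand above a
  -- running transaction.
  Exposed : ∀ {m n} → TrN → Term m n → Set
  Exposed k (P ∣ Q)        = Exposed k P ⊎ Exposed k Q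
  Exposed k (ν P)          = Exposed k P
  Exposed k ⟦ P ▷[ l ] Q ⟧ = k ≡ l
  Exposed k _              = ⊥

  nameless-⊑ : ∀ {m n m′ n′} {U : Term m n} {T : Term m′ n′} → U ⊑ T → Nameless T → Nameless U
  nameless-⊑ here      p = p
  nameless-⊑ (sum i u) p = nameless-⊑ u (p i)
  nameless-⊑ (parˡ u)  p = nameless-⊑ u (proj₁ p)
  nameless-⊑ (parʳ u)  p = nameless-⊑ u (proj₂ p)
  nameless-⊑ (res u)   p = nameless-⊑ u p
  nameless-⊑ (rec u)   p = nameless-⊑ u p
  nameless-⊑ (dormˡ u) p = nameless-⊑ u (proj₁ p)
  nameless-⊑ (dormʳ u) p = nameless-⊑ u (proj₂ p)

  nameless⇒nameFree : ∀ {m n} {T : Term m n} → Nameless T → NameFree T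
  nameless⇒nameFree p k (_ , _ , _ , _ , u) = nameless-⊑ u p

  nameFree-⊑ : ∀ {m n m′ n′} {U : Term m n} {T : Term m′ n′} →
               (∀ {m″ n″} {V : Term m″ n″} → V ⊑ U → V ⊑ T) → NameFree T → NameFree U
  nameFree-⊑ i p k (_ , _ , _ , _ , u) = p k (_ , _ , _ , _ , i u)

  nameFree⇒nameless : ∀ {m n} (T : Term m n) → NameFree T → Nameless T
  nameFree⇒nameless (∑ J μ P) p i      = nameFree⇒nameless (P i) (nameFree-⊑ (sum i) p)
  nameFree⇒nameless (P ∣ Q) p          = nameFree⇒nameless P (nameFree-⊑ parˡ p) ,
                                         nameFree⇒nameless Q (nameFree-⊑ parʳ p)
  nameFree⇒nameless (ν P) p            = nameFree⇒nameless P (nameFree-⊑ res p)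
  nameFree⇒nameless (var X) p          = tt
  nameFree⇒nameless (rec P) p          = nameFree⇒nameless P (nameFree-⊑ rec p)
  nameFree⇒nameless ⟦ P ▷[ k ] Q ⟧ p   = p k (_ , _ , _ , _ , here)
  nameFree⇒nameless co p               = tt
  nameFree⇒nameless ⟦ P ▶ Q ⟧ p        = nameFree⇒nameless P (nameFree-⊑ dormˡ p) ,
                                         nameFree⇒nameless Q (nameFree-⊑ dormʳ p)

  nameless⇒wellPlaced : ∀ {m n} (T : Term m n) → Nameless T → WellPlaced T
  nameless⇒wellPlaced (∑ J μ P) p    = p
  nameless⇒wellPlaced (P ∣ Q) (p , q) = nameless⇒wellPlaced P p , nameless⇒wellPlaced Q q
  nameless⇒wellPlaced (ν P) p        = nameless⇒wellPlaced P p
  nameless⇒wellPlaced (var X) p      = tt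
  nameless⇒wellPlaced (rec P) p      = p
  nameless⇒wellPlaced co p           = tt
  nameless⇒wellPlaced ⟦ P ▶ Q ⟧ p    = p

  nameless⇒¬exposed : ∀ {m n k} (T : Term m n) → Nameless T → ¬ Exposed k T
  nameless⇒¬exposed (P ∣ Q) (p , q) = [ nameless⇒¬exposed P p , nameless⇒¬exposed Q q ]′
  nameless⇒¬exposed (ν P) p         = nameless⇒¬exposed P p

  wellPlaced-⊑ : ∀ {m n m′ n′} {U : Term m n} {T : Term m′ n′} →
                 U ⊑ T → WellPlaced T → WellPlaced U
  nameless-⊑ʷ : ∀ {m n m′ n′} {U : Term m n} {T : Term m′ n′} →
                U ⊑ T → Nameless T → WellPlaced U
  nameless-⊑ʷ {U = U} u p = nameless⇒wellPlaced U (nameless-⊑ u p)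

  wellPlaced-⊑ here      p = p
  wellPlaced-⊑ (sum i u) p = nameless-⊑ʷ u (p i)
  wellPlaced-⊑ (parˡ u)  p = wellPlaced-⊑ u (proj₁ p)
  wellPlaced-⊑ (parʳ u)  p = wellPlaced-⊑ u (proj₂ p)
  wellPlaced-⊑ (res u)   p = wellPlaced-⊑ u p
  wellPlaced-⊑ (rec u)   p = nameless-⊑ʷ u p
  wellPlaced-⊑ (runˡ u)  p = nameless-⊑ʷ u (proj₁ p)
  wellPlaced-⊑ (runʳ u)  p = nameless-⊑ʷ u (proj₂ p)
  wellPlaced-⊑ (dormˡ u) p = nameless-⊑ʷ u (proj₁ p)
  wellPlaced-⊑ (dormʳ u) p = nameless-⊑ʷ u (proj₂ p)

  exposed⇒∈ftn : ∀ {m n k} (T : Term m n) → Exposed k T → k ∈ftn T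
  exposed⇒∈ftn (P ∣ Q) (inj₁ e) with exposed⇒∈ftn P e
  ... | _ , _ , _ , _ , u = _ , _ , _ , _ , parˡ u
  exposed⇒∈ftn (P ∣ Q) (inj₂ e) with exposed⇒∈ftn Q e
  ... | _ , _ , _ , _ , u = _ , _ , _ , _ , parʳ u
  exposed⇒∈ftn (ν P) e with exposed⇒∈ftn P e
  ... | _ , _ , _ , _ , u = _ , _ , _ , _ , res u
  exposed⇒∈ftn ⟦ P ▷[ k ] Q ⟧ refl = _ , _ , _ , _ , here

  run-exposed : ∀ {m n m′ n′ k} {P : Term m 0} {Q : Term m n} {T : Term m′ n′} →
                WellPlaced T → ⟦ P ▷[ k ] Q ⟧ ⊑ T → Exposed k T
  run-exposed p here            = refl
  run-exposed p (sum i u)       = ⊥-elim (nameless-⊑ u (p i))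
  run-exposed p (parˡ u)        = inj₁ (run-exposed (proj₁ p) u)
  run-exposed p (parʳ u)        = inj₂ (run-exposed (proj₂ p) u)
  run-exposed p (res u)         = run-exposed p u
  run-exposed p (rec u)         = ⊥-elim (nameless-⊑ u p)
  run-exposed (p , q) (runˡ u)  = ⊥-elim (nameless-⊑ u p)
  run-exposed (p , q) (runʳ u)  = ⊥-elim (nameless-⊑ u q)
  run-exposed (p , q) (dormˡ u) = ⊥-elim (nameless-⊑ u p)
  run-exposed (p , q) (dormʳ u) = ⊥-elim (nameless-⊑ u q)

  ∈ftn⇒exposed : ∀ {m n k} {T : Term m n} → WellPlaced T → k ∈ftn T → Exposed k T
  ∈ftn⇒exposed p (_ , _ , _ , _ , u) = run-exposed p u

  exposedNames : ∀ {m n} → Term m n → List TrN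
  exposedNames (P ∣ Q)        = exposedNames P ++ exposedNames Q
  exposedNames (ν P)          = exposedNames P
  exposedNames ⟦ P ▷[ k ] Q ⟧ = [ k ]
  exposedNames _              = []

  exposed⇒∈ : ∀ {m n k} (T : Term m n) → Exposed k T → k ∈ exposedNames T
  exposed⇒∈ (P ∣ Q) (inj₁ e)      = ∈-++⁺ˡ (exposed⇒∈ P e)
  exposed⇒∈ (P ∣ Q) (inj₂ e)      = ∈-++⁺ʳ (exposedNames P) (exposed⇒∈ Q e)
  exposed⇒∈ (ν P) e               = exposed⇒∈ P e
  exposed⇒∈ ⟦ P ▷[ k ] Q ⟧ refl   = here refl

  wellNamed-⊑ : ∀ {m n m′ n′} {U : Term m n} {T : Term m′ n′} →
                (∀ {m″ n″} {V : Term m″ n″} → V ⊑ U → V ⊑ T) → WellNamed T → WellNamed U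
  wellNamed-⊑ i w = record
    { ftn-finite = proj₁ ftn-finite ,
                   λ { k (_ , _ , _ , _ , u) → proj₂ ftn-finite k (_ , _ , _ , _ , i u) }
    ; running    = running ∘ i
    ; dormant    = dormant ∘ i
    ; sums       = sums ∘ i
    ; recs       = recs ∘ i
    }
    where open WellNamed w

  wellNamed⇒wellPlaced : ∀ {m n} (T : Term m n) → WellNamed T → WellPlaced T
  wellNamed⇒wellPlaced (∑ J μ P) w i    = nameFree⇒nameless _ (WellNamed.sums w here i)
  wellNamed⇒wellPlaced (P ∣ Q) w        = wellNamed⇒wellPlaced P (wellNamed-⊑ parˡ w) ,
                                          wellNamed⇒wellPlaced Q (wellNamed-⊑ parʳ w)
  wellNamed⇒wellPlaced (ν P) w          = wellNamed⇒wellPlaced P (wellNamed-⊑ res w)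
  wellNamed⇒wellPlaced (var X) w        = tt
  wellNamed⇒wellPlaced (rec P) w        = nameFree⇒nameless P (WellNamed.recs w here)
  wellNamed⇒wellPlaced ⟦ P ▷[ k ] Q ⟧ w with WellNamed.running w here
  ... | p , q = nameFree⇒nameless P p , nameFree⇒nameless Q q
  wellNamed⇒wellPlaced co w             = tt
  wellNamed⇒wellPlaced ⟦ P ▶ Q ⟧ w      with WellNamed.dormant w here
  ... | p , q = nameFree⇒nameless P p , nameFree⇒nameless Q q

  wellPlaced⇒wellNamed : ∀ {m n} (T : Term m n) → WellPlaced T → WellNamed T
  wellPlaced⇒wellNamed T w = record
    { ftn-finite = exposedNames T , λ k k∈T → exposed⇒∈ T (∈ftn⇒exposed w k∈T)
    ; running    = λ u → let p , q = wellPlaced-⊑ u w in nameless⇒nameFree p , nameless⇒nameFree q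
    ; dormant    = λ u → let p , q = wellPlaced-⊑ u w in nameless⇒nameFree p , nameless⇒nameFree q
    ; sums       = λ u i → nameless⇒nameFree (wellPlaced-⊑ u w i)
    ; recs       = λ u → nameless⇒nameFree (wellPlaced-⊑ u w)
    }

  nameless-renameC : ∀ {m m′ n} (ρ : Fin m → Fin m′) (T : Term m n) →
                     Nameless T → Nameless (renameC ρ T)
  nameless-renameC ρ (∑ J μ P) p i      = nameless-renameC ρ (P i) (p i)
  nameless-renameC ρ (P ∣ Q) (p , q)    = nameless-renameC ρ P p , nameless-renameC ρ Q q
  nameless-renameC ρ (ν P) p            = nameless-renameC (lift 1 ρ) P p
  nameless-renameC ρ (var X) p          = tt
  nameless-renameC ρ (rec P) p          = nameless-renameC ρ P p
  nameless-renameC ρ co p               = tt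
  nameless-renameC ρ ⟦ P ▶ Q ⟧ (p , q)  = nameless-renameC ρ P p , nameless-renameC ρ Q q

  nameless-renameV : ∀ {m n n′} (ρ : Fin n → Fin n′) (T : Term m n) →
                     Nameless T → Nameless (renameV ρ T)
  nameless-renameV ρ (∑ J μ P) p i      = nameless-renameV ρ (P i) (p i)
  nameless-renameV ρ (P ∣ Q) (p , q)    = nameless-renameV ρ P p , nameless-renameV ρ Q q
  nameless-renameV ρ (ν P) p            = nameless-renameV ρ P p
  nameless-renameV ρ (var X) p          = tt
  nameless-renameV ρ (rec P) p          = nameless-renameV (lift 1 ρ) P p
  nameless-renameV ρ co p               = tt
  nameless-renameV ρ ⟦ P ▶ Q ⟧ (p , q)  = p , nameless-renameV ρ Q q

  nameless-sub : ∀ {m n n′} (θ : Fin n → Term m n′) (T : Term m n) →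
                 Nameless T → (∀ X → Nameless (θ X)) → Nameless (sub θ T)
  nameless-sub θ (∑ J μ P) p t i     = nameless-sub θ (P i) (p i) t
  nameless-sub θ (P ∣ Q) (p , q) t   = nameless-sub θ P p t , nameless-sub θ Q q t
  nameless-sub θ (ν P) p t           =
    nameless-sub (renameC suc ∘ θ) P p (λ X → nameless-renameC suc (θ X) (t X))
  nameless-sub θ (var X) p t         = t X
  nameless-sub θ (rec P) p t         = nameless-sub (liftSub θ) P p λ
    { zero → tt ; (suc X) → nameless-renameV suc (θ X) (t X) }
  nameless-sub θ co p t              = tt
  nameless-sub θ ⟦ P ▶ Q ⟧ (p , q) t = p , nameless-sub θ Q q t

  nameless-unfold : ∀ {m n} (P : Term m (suc n)) {R : Term m n} →
                    Nameless P → Nameless R → Nameless (P [ R /X])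
  nameless-unfold P p r = nameless-sub _ P p λ { zero → r ; (suc X) → tt }

  nameless-⇝co : ∀ {m n} {P Q : Term m n} → P ⇝co Q → Nameless P → Nameless Q
  nameless-⇝co co        p       = λ ()
  nameless-⇝co sum       p       = p
  nameless-⇝co var       p       = p
  nameless-⇝co rec       p       = p
  nameless-⇝co dorm      p       = p
  nameless-⇝co (res c)   p       = nameless-⇝co c p
  nameless-⇝co (par c d) (p , q) = nameless-⇝co c p , nameless-⇝co d q

  apply-cases : ∀ σ k → apply σ k ≡ k ⊎ apply σ k ∈ range σ
  apply-cases ε k = inj₁ refl
  apply-cases (ks ↦ l) k with k ∈ᵗ? ks
  ... | yes _ = inj₂ (here refl)
  ... | no  _ = inj₁ refl

  exposed-⟨⟩ : ∀ {m n k} σ (T : Term m n) → Exposed k (T ⟨ σ ⟩) → Exposed k T ⊎ k ∈ range σ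
  exposed-⟨⟩ σ (P ∣ Q) (inj₁ e) = Sum.map₁ inj₁ (exposed-⟨⟩ σ P e)
  exposed-⟨⟩ σ (P ∣ Q) (inj₂ e) = Sum.map₁ inj₂ (exposed-⟨⟩ σ Q e)
  exposed-⟨⟩ σ (ν P) e = exposed-⟨⟩ σ P e
  exposed-⟨⟩ σ ⟦ P ▷[ k ] Q ⟧ refl = apply-cases σ k

  -- Names enter the domain by `trun` alone, which renames a transaction that is already running; a
  -- transaction created by `tsum` contributes none.
  dom-exposed : ∀ {m α σ k} {P Q : Term m 0} → P —[ α , σ ]→ Q → k ∈ dom σ → Exposed k P
  dom-exposed (trun _ _) (here refl) = refl
  dom-exposed (tcom {ls₁ = ls₁} s t) k∈ with ∈-++⁻ ls₁ k∈
  ... | inj₁ k∈₁ = inj₁ (dom-exposed s k∈₁)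
  ... | inj₂ k∈₂ = inj₂ (dom-exposed t k∈₂)
  dom-exposed (parˡ s _) k∈ = inj₁ (dom-exposed s k∈)
  dom-exposed (parʳ s _) k∈ = inj₂ (dom-exposed s k∈)
  dom-exposed (res s) k∈ = dom-exposed s k∈

  step-exposed : ∀ {m α σ k} {P Q : Term m 0} → WellPlaced P → P —[ α , σ ]→ Q →
                 Exposed k Q → Exposed k P ⊎ k ∈ range σ
  step-exposed w (sum {P = P} j) e = ⊥-elim (nameless⇒¬exposed (P j) (w j) e)
  step-exposed (w , v) (com s t) (inj₁ e) = Sum.map₁ inj₁ (step-exposed w s e)
  step-exposed (w , v) (com s t) (inj₂ e) = Sum.map₁ inj₂ (step-exposed v t e)
  step-exposed w (rec {P}) e =
    ⊥-elim (nameless⇒¬exposed (P [ rec P /X]) (nameless-unfold P {rec P} w w) e)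
  step-exposed w (tsum j _) refl = inj₂ (here refl)
  step-exposed w (trun _ _) refl = inj₂ (here refl)
  step-exposed (w , v) (tcom {P′ = P′} {k = k} {ls₂ = ls₂} s t) (inj₁ e)
    with exposed-⟨⟩ (ls₂ ↦ k) P′ e
  ... | inj₁ e′ = Sum.map₁ inj₁ (step-exposed w s e′)
  ... | inj₂ k∈ = inj₂ k∈
  step-exposed (w , v) (tcom {Q′ = Q′} {k = k} {ls₁ = ls₁} s t) (inj₂ e)
    with exposed-⟨⟩ (ls₁ ↦ k) Q′ e
  ... | inj₁ e′ = Sum.map₁ inj₂ (step-exposed v t e′)
  ... | inj₂ k∈ = inj₂ k∈
  step-exposed (w , v) (parˡ s _) (inj₁ e) = Sum.map₁ inj₁ (step-exposed w s e)
  step-exposed (w , v) (parˡ {Q = Q} {σ = σ} s _) (inj₂ e) = Sum.map₁ inj₂ (exposed-⟨⟩ σ Q e)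
  step-exposed (w , v) (parʳ {P = P} {σ = σ} s _) (inj₁ e) = Sum.map₁ inj₁ (exposed-⟨⟩ σ P e)
  step-exposed (w , v) (parʳ s _) (inj₂ e) = Sum.map₁ inj₂ (step-exposed v s e)
  step-exposed w (res s) e = step-exposed w s e

  labelNames : ∀ {m} → Label m → List TrN
  labelNames (plain μ) = []
  labelNames (k ⦅ μ ⦆) = [ k ]

  labelNames-weaken : ∀ {m} (α : Label m) → labelNames (weaken α) ≡ labelNames α
  labelNames-weaken (plain μ) = refl
  labelNames-weaken (k ⦅ μ ⦆) = refl

  range-label : ∀ {m α σ} {P Q : Term m 0} → P —[ α , σ ]→ Q → range σ ≡ labelNames α
  range-label (sum j)    = refl
  range-label (com _ _)  = refl
  range-label rec        = refl
  range-label (tsum _ _) = refl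
  range-label (trun _ _) = refl
  range-label (tcom _ _) = refl
  range-label (parˡ s _) = range-label s
  range-label (parʳ s _) = range-label s
  range-label (res {α = α} s) = trans (range-label s) (labelNames-weaken α)

  data Closing : Reconf → Set where
    co : ∀ {k} → Closing (co k)
    ab : ∀ {k} → Closing (ab k)

  closing-exposed : ∀ {m β} {P Q : Term m 0} → Closing β → P —[ β ]→ʳ Q → Exposed (trn β) P
  closing-exposed c (commit _ _) = refl
  closing-exposed () start
  closing-exposed c abort        = refl
  closing-exposed c (parco s t)  = inj₁ (closing-exposed c s)
  closing-exposed c (parab s t)  = inj₁ (closing-exposed c s)
  closing-exposed c (parˡ s _)   = inj₁ (closing-exposed c s)
  closing-exposed c (parʳ s _)   = inj₂ (closing-exposed c s)
  closing-exposed c (res s)      = closing-exposed c s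

  -- All transactions of one name close together: `parco` and `parab` close both sides, `parˡ` and
  -- `parʳ` require the other side to lack the name, and what a closed transaction leaves behind is
  -- nameless.
  closing-hidden : ∀ {m β} {P Q : Term m 0} → WellPlaced P → Closing β → P —[ β ]→ʳ Q →
                   ¬ Exposed (trn β) Q
  closing-hidden (p , q) c (commit {P′ = P′} _ r) e = nameless⇒¬exposed P′ (nameless-⇝co r p) e
  closing-hidden w () start e
  closing-hidden (p , q) c (abort {Q = Q}) e    = nameless⇒¬exposed Q q e
  closing-hidden (w , v) c (parco s t) (inj₁ e) = closing-hidden w c s e
  closing-hidden (w , v) c (parco s t) (inj₂ e) = closing-hidden v c t e
  closing-hidden (w , v) c (parab s t) (inj₁ e) = closing-hidden w c s e
  closing-hidden (w , v) c (parab s t) (inj₂ e) = closing-hidden v c t e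
  closing-hidden (w , v) c (parˡ s f) (inj₁ e)  = closing-hidden w c s e
  closing-hidden (w , v) c (parˡ s f) (inj₂ e)  = f (exposed⇒∈ftn _ e)
  closing-hidden (w , v) c (parʳ s f) (inj₁ e)  = f (exposed⇒∈ftn _ e)
  closing-hidden (w , v) c (parʳ s f) (inj₂ e)  = closing-hidden v c s e
  closing-hidden w c (res s) e                  = closing-hidden w c s e

  reconf-exposed : ∀ {m β k} {P Q : Term m 0} → WellPlaced P → P —[ β ]→ʳ Q →
                   Exposed k Q → Exposed k P ⊎ k ≡ trn β
  reconf-exposed (p , q) (commit {P′ = P′} _ r) e =
    ⊥-elim (nameless⇒¬exposed P′ (nameless-⇝co r p) e)
  reconf-exposed w start e                = inj₂ e
  reconf-exposed (p , q) (abort {Q = Q}) e = ⊥-elim (nameless⇒¬exposed Q q e)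
  reconf-exposed (w , v) (parco s t) (inj₁ e) = Sum.map₁ inj₁ (reconf-exposed w s e)
  reconf-exposed (w , v) (parco s t) (inj₂ e) = Sum.map₁ inj₂ (reconf-exposed v t e)
  reconf-exposed (w , v) (parab s t) (inj₁ e) = Sum.map₁ inj₁ (reconf-exposed w s e)
  reconf-exposed (w , v) (parab s t) (inj₂ e) = Sum.map₁ inj₂ (reconf-exposed v t e)
  reconf-exposed (w , v) (parˡ s _) (inj₁ e)  = Sum.map₁ inj₁ (reconf-exposed w s e)
  reconf-exposed (w , v) (parˡ s _) (inj₂ e)  = inj₁ (inj₂ e)
  reconf-exposed (w , v) (parʳ s _) (inj₁ e)  = inj₁ (inj₁ e)
  reconf-exposed (w , v) (parʳ s _) (inj₂ e)  = Sum.map₁ inj₂ (reconf-exposed v s e)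
  reconf-exposed w (res s) e                  = reconf-exposed w s e

  -- The effect of transitions on names, equivalence and history

  settle-∈⁻ : ∀ {s E k i k′ t} H → (i , k′ , t) ∈ settle s E k H →
              ∃[ s′ ] (i , k′ , s′) ∈ H ×
              (((inj₂ k′ , k) ∈ E × t ≡ resolve s s′) ⊎ ((inj₂ k′ , k) ∉ E × t ≡ s′))
  settle-∈⁻ {E = E} {k = k} ((_ , k′ , s′) ∷ H) (here eq) with (inj₂ k′ , k) ∈ᵖ? E | eq
  ... | yes r | refl = s′ , here refl , inj₁ (r , refl)
  ... | no ¬r | refl = s′ , here refl , inj₂ (¬r , refl)
  settle-∈⁻ (_ ∷ H) (there t∈) with settle-∈⁻ H t∈
  ... | s′ , s′∈ , r = s′ , there s′∈ , r

  settle-related : ∀ {s E k i k′ s′} H → (i , k′ , s′) ∈ H → (inj₂ k′ , k) ∈ E →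
                   (i , k′ , resolve s s′) ∈ settle s E k H
  settle-related {E = E} {k = k} {k′ = k′} (_ ∷ H) (here refl) r with (inj₂ k′ , k) ∈ᵖ? E
  ... | yes _ = here refl
  ... | no ¬r = contradiction r ¬r
  settle-related (_ ∷ H) (there s∈) r = there (settle-related H s∈ r)

  settle-unrelated : ∀ {s E k i k′ s′} H → (i , k′ , s′) ∈ H → (inj₂ k′ , k) ∉ E →
                     (i , k′ , s′) ∈ settle s E k H
  settle-unrelated {E = E} {k = k} {k′ = k′} (_ ∷ H) (here refl) ¬r with (inj₂ k′ , k) ∈ᵖ? E
  ... | yes r = contradiction r ¬r
  ... | no _  = here refl
  settle-unrelated (_ ∷ H) (there s∈) ¬r = there (settle-unrelated H s∈ ¬r)

  hasco-settle⁺ : ∀ {s E k k′} H → k′ ∈Hasco H → k′ ∈Hasco settle s E k H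
  hasco-settle⁺ {E = E} {k} {k′} H (i , c∈) with (inj₂ k′ , k) ∈ᵖ? E
  ... | yes r = i , settle-related H c∈ r
  ... | no ¬r = i , settle-unrelated H c∈ ¬r

  hasco-settle-ab : ∀ {E k k′} H → k′ ∈Hasco settle ab E k H → k′ ∈Hasco H
  hasco-settle-ab H (i , c∈) with settle-∈⁻ H c∈
  ... | co    , s∈ , inj₁ (_ , refl) = i , s∈
  ... | act _ , s∈ , inj₁ (_ , ())
  ... | ab    , s∈ , inj₁ (_ , ())
  ... | _     , s∈ , inj₂ (_ , refl) = i , s∈

  hasco-settle-co : ∀ {E k k′} H → k′ ∈Hasco settle co E k H → k′ ∈Hasco H ⊎ (inj₂ k′ , k) ∈ E
  hasco-settle-co H (i , c∈) with settle-∈⁻ H c∈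
  ... | _ , s∈ , inj₁ (r , _)    = inj₂ r
  ... | _ , s∈ , inj₂ (_ , refl) = inj₁ (i , s∈)

  htrn-settle⁻ : ∀ {s E k k′} H → k′ ∈Htrn settle s E k H → k′ ∈Htrn H
  htrn-settle⁻ H (i , _ , t∈) with settle-∈⁻ H t∈
  ... | s′ , s∈ , _ = i , s′ , s∈

  -- The one class of σ(E) that the merge creates. The alternative `x ≡ d` is there because E is
  -- reflexive only on its own field, to which `d` need not belong.
  Touched : Subst → Eqv → TrN → Set
  Touched σ E x = ∃[ d ] (d ∈ dom σ ⊎ d ∈ range σ) × (x ≡ d ⊎ (d , x) ∈ E)

  -- The restriction of F to the pairs of the conclusion is closed, so F lies in it.
  merge-cases : ∀ {σ E F x y} →
                (∀ {k l} → (k , l) ∈ E → (l , k) ∈ E) →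
                (∀ {k l m} → (k , l) ∈ E → (l , m) ∈ E → (k , m) ∈ E) →
                σ ⟪ E ⟫= F → (x , y) ∈ F → (x , y) ∈ E ⊎ (Touched σ E x × Touched σ E y)
  merge-cases {σ} {E} {F} E-sym E-trans (closed , least) xy =
    proj₂ (∈-filter⁻ pair? {xs = F} (least (filter pair? F) filter-closed xy))
    where
    open ClosedUnder closed renaming (sym to F-sym; trans to F-trans)
    Pair : TrN × TrN → Set
    Pair (x , y) = (x , y) ∈ E ⊎ (Touched σ E x × Touched σ E y)
    -- `Touched` is an existential over all names, so the decision needed by `filter` is taken
    -- classically.
    pair? = λ p → em 0ℓ {Pair p}
    touched-trans : ∀ {x y} → Touched σ E x → (x , y) ∈ E → Touched σ E y
    touched-trans (d , d∈ , inj₁ refl) r = d , d∈ , inj₂ r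
    touched-trans (d , d∈ , inj₂ dx)   r = d , d∈ , inj₂ (E-trans dx r)
    pair-sym : ∀ {x y} → Pair (x , y) → Pair (y , x)
    pair-sym (inj₁ r)       = inj₁ (E-sym r)
    pair-sym (inj₂ (t , u)) = inj₂ (u , t)
    pair-trans : ∀ {x y z} → Pair (x , y) → Pair (y , z) → Pair (x , z)
    pair-trans (inj₁ r)       (inj₁ q)       = inj₁ (E-trans r q)
    pair-trans (inj₁ r)       (inj₂ (t , u)) = inj₂ (touched-trans t (E-sym r) , u)
    pair-trans (inj₂ (t , u)) (inj₁ q)       = inj₂ (t , touched-trans u q)
    pair-trans (inj₂ (t , _)) (inj₂ (_ , u)) = inj₂ (t , u)
    filter-closed : ClosedUnder σ E (filter pair? F)
    filter-closed = record
      { sym     = λ r → let q , p = ∈-filter⁻ pair? {xs = F} r in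
                  ∈-filter⁺ pair? (F-sym q) (pair-sym p)
      ; trans   = λ r r′ → let q , p = ∈-filter⁻ pair? {xs = F} r
                               q′ , p′ = ∈-filter⁻ pair? {xs = F} r′ in
                  ∈-filter⁺ pair? (F-trans q q′) (pair-trans p p′)
      ; extends = λ r → ∈-filter⁺ pair? (extends r) (inj₁ r)
      ; target  = λ l∈ → ∈-filter⁺ pair? (target l∈)
                  (inj₂ ((_ , inj₂ l∈ , inj₁ refl) , (_ , inj₂ l∈ , inj₁ refl)))
      ; merges  = λ k∈ l∈ → ∈-filter⁺ pair? (merges k∈ l∈)
                  (inj₂ ((_ , inj₁ k∈ , inj₁ refl) , (_ , inj₂ l∈ , inj₁ refl)))
      }

  -- Running transactions are related to pending external names only

  Pending : Hist → exTrN → Set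
  Pending H k = ∃₂ λ i a → (i , k , act a) ∈ H

  -- An invariant of the configurations reachable from processes that is not
  -- part of IsConfig.
  Live : RawConfig → Set
  Live ⟨ E ⨾ H ∙ P ⟩ = ∀ {k k′} → Exposed k P → (k , inj₂ k′) ∈ E → Pending H k′

  pending⇒¬hasco : ∀ {E H P k} → IsConfig ⟨ E ⨾ H ∙ P ⟩ → Pending H k → ¬ k ∈Hasco H
  pending⇒¬hasco v (i , a , p) (j , c) with IsConfig.H-unique v p c
  ... | refl with IsConfig.H-function v p c
  ... | ()

  module _ {E H P} (v : IsConfig ⟨ E ⨾ H ∙ P ⟩) where
    open IsConfig v

    wellPlaced : WellPlaced P
    wellPlaced = wellNamed⇒wellPlaced P wellNamed

    -- A name in the domain is exposed in P, so `Live` applies to whatever E relates to it; if it is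
    -- external itself, it lies in the history and hence is related to itself. The only name in the
    -- range is the fresh one, which E does not mention.
    touched-external : ∀ {α σ Q k k′} → Live ⟨ E ⨾ H ∙ P ⟩ → P —[ α , σ ]→ Q → labelNames α ≡ [ k ] →
                       Fresh k E H → Touched σ E (inj₂ k′) → inj₂ k′ ≡ k ⊎ Pending H k′
    touched-external live s eq f (d , inj₁ d∈ , inj₁ refl) =
      inj₂ (live d! (Equivalence.from (E-external _) (P-external (exposed⇒∈ftn P d!))))
      where d! = dom-exposed s d∈
    touched-external live s eq f (d , inj₁ d∈ , inj₂ r) = inj₂ (live (dom-exposed s d∈) r)
    touched-external live s eq f (d , inj₂ d∈ , r) with subst (d ∈_) (trans (range-label s) eq) d∈ | r
    ... | here refl | inj₁ eq′ = inj₁ eq′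
    ... | here refl | inj₂ r′ = contradiction r′ (Fresh.E-freshˡ f)

    live-merge : ∀ {α σ Q k F l k′} → Live ⟨ E ⨾ H ∙ P ⟩ → P —[ α , σ ]→ Q → labelNames α ≡ [ k ] →
                 Fresh k E H → σ ⟪ E ⟫= F → Exposed l Q → (l , inj₂ k′) ∈ F →
                 inj₂ k′ ≡ k ⊎ Pending H k′
    live-merge live s eq f merge e r with merge-cases E-sym E-trans merge r
    ... | inj₂ (_ , t) = touched-external live s eq f t
    ... | inj₁ r′ with step-exposed wellPlaced s e
    ... | inj₁ e′ = inj₂ (live e′ r′)
    ... | inj₂ l∈ with subst (_ ∈_) (trans (range-label s) eq) l∈
    ... | here refl = contradiction r′ (Fresh.E-freshˡ f)

    live-close : ∀ {β s Q l k′} → Live ⟨ E ⨾ H ∙ P ⟩ → Closing β → P —[ β ]→ʳ Q →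
                 Exposed l Q → (l , inj₂ k′) ∈ E → Pending (settle s E (trn β) H) k′
    live-close {Q = Q} live c st e r with reconf-exposed wellPlaced st e
    ... | inj₂ refl = contradiction e (closing-hidden wellPlaced c st)
    ... | inj₁ e′ with live e′ r
    -- The entry of `k′` survives because it is not related to the closed name: otherwise `l` would
    -- be too, both would occur in P, and `P-distinct` would identify them, although the closed name
    -- is no longer exposed in Q.
    ... | i , a , p = i , a , settle-unrelated H p λ r′ →
      closing-hidden wellPlaced c st (subst (λ l → Exposed l Q)
        (P-distinct (E-trans r r′) (exposed⇒∈ftn P e′) (exposed⇒∈ftn P (closing-exposed c st))) e)

  live-step : ∀ {s ζ C D} → IsConfig C → Live C → Step s C ζ D → Live D
  live-step v live (tau s) e r with step-exposed (wellPlaced v) s e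
  ... | inj₁ e′ = live e′ r
  live-step v live (ktau s f m) e r with live-merge v live s refl f m e r
  ... | inj₂ p = p
  live-step v live (start s f) e r with reconf-exposed (wellPlaced v) s e
  ... | inj₁ e′   = live e′ r
  ... | inj₂ refl = contradiction r (Fresh.E-freshˡ f)
  live-step v live (commit s) e r = live-close v live co s e r
  live-step v live (commitᵉ s _ _) e r = live-close v live co s e r
  live-step v live (commitⁱ s _) e r = live-close v live co s e r
  live-step v live (abort s) e r = live-close v live ab s e r
  live-step v live (kact s f m _) e r with live-merge v live s refl f m e r
  ... | inj₁ refl        = _ , _ , here refl
  ... | inj₂ (i , a , p) = i , a , there p
  -- The new name enters the history as aborted, which is harmless: the added pair relates it only
  -- to itself, and P does not contain it.
  live-step v live (kabort f ♯P _) e (here refl) = contradiction (exposed⇒∈ftn _ e) ♯P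
  live-step v live (kabort f ♯P _) e (there r) with live e r
  ... | i , a , p = i , a , there p

  eqv-step : ∀ {s ζ C D p} → Step s C ζ D → p ∈ RawConfig.eqv C → p ∈ RawConfig.eqv D
  eqv-step (tau _) r                  = r
  eqv-step (ktau _ _ (closed , _)) r  = ClosedUnder.extends closed r
  eqv-step (start _ _) r              = r
  eqv-step (commit _) r               = r
  eqv-step (commitᵉ _ _ _) r          = r
  eqv-step (commitⁱ _ _) r            = r
  eqv-step (abort _) r                = r
  eqv-step (kact _ _ (closed , _) _) r = ClosedUnder.extends closed r
  eqv-step (kabort _ _ _) r           = there r

  opened : ExtLabel → List exTrN
  opened (k ⦅ _ ⦆) = [ k ]
  opened _         = []

  htrn-step : ∀ {s ζ C D k} → Step s C ζ D → k ∈Htrn RawConfig.hist D →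
              k ∈Htrn RawConfig.hist C ⊎ k ∈ opened ζ
  htrn-step (tau _) h          = inj₁ h
  htrn-step (ktau _ _ _) h     = inj₁ h
  htrn-step (start _ _) h      = inj₁ h
  htrn-step (commit _) h       = inj₁ (htrn-settle⁻ _ h)
  htrn-step (commitᵉ _ _ _) h  = inj₁ (htrn-settle⁻ _ h)
  htrn-step (commitⁱ _ _) h    = inj₁ (htrn-settle⁻ _ h)
  htrn-step (abort _) h        = inj₁ (htrn-settle⁻ _ h)
  htrn-step (kact _ _ _ _) (_ , _ , here refl) = inj₂ (here refl)
  htrn-step (kact _ _ _ _) (i , s , there h)   = inj₁ (i , s , h)
  htrn-step (kabort _ _ _) (_ , _ , here refl) = inj₂ (here refl)
  htrn-step (kabort _ _ _) (i , s , there h)   = inj₁ (i , s , h)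

  -- The diagonal of this relation is the interpretation of Hasco.
  CoEq : RawConfig → exTrN → exTrN → Set
  CoEq ⟨ E ⨾ H ∙ P ⟩ k k′ = k ∈Hasco H × k′ ∈Hasco H × (inj₂ k , inj₂ k′) ∈ E

  committed : ExtLabel → List exTrN
  committed (co K) = K
  committed _      = []

  -- Among external names, a merge affects only the fresh one and pending ones; a committed name is
  -- neither, so its class stays as it was.
  coEq-merge⁻ : ∀ {E H P α σ Q κ F k k′} → IsConfig ⟨ E ⨾ H ∙ P ⟩ → Live ⟨ E ⨾ H ∙ P ⟩ →
                P —[ α , σ ]→ Q → labelNames α ≡ [ κ ] → Fresh κ E H → σ ⟪ E ⟫= F →
                k ∈Hasco H → (inj₂ k , inj₂ k′) ∈ F → (inj₂ k , inj₂ k′) ∈ E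
  coEq-merge⁻ v live s eq f m h r with merge-cases (IsConfig.E-sym v) (IsConfig.E-trans v) m r
  ... | inj₁ r′ = r′
  ... | inj₂ (t , _) with touched-external v live s eq f t
  ... | inj₁ refl = contradiction (proj₁ h , co , proj₂ h) (Fresh.H-fresh f refl)
  ... | inj₂ p    = contradiction h (pending⇒¬hasco v p)

  coEq-step⁺ : ∀ {ζ C D k k′} → IsConfig C → Live C → Step commit-sensitive C ζ D →
               CoEq C k k′ ⊎ (k ∈ committed ζ × k′ ∈ committed ζ) → CoEq D k k′
  coEq-step⁺ v live (tau _) (inj₁ c)      = c
  coEq-step⁺ v live (ktau _ _ (closed , _)) (inj₁ (h , h′ , r)) = h , h′ , ClosedUnder.extends closed r
  coEq-step⁺ v live (start _ _) (inj₁ c)  = c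
  coEq-step⁺ v live (commitᵉ {H = H} _ _ _) (inj₁ (h , h′ , r)) = hasco-settle⁺ H h , hasco-settle⁺ H h′ , r
  coEq-step⁺ v live (commitᵉ {H = H} s K _) (inj₂ (k∈ , k′∈)) =
    newly r , newly r′ , IsConfig.E-trans v (IsConfig.E-sym v r) r′
    where
    r = Equivalence.to (K _) k∈
    r′ = Equivalence.to (K _) k′∈
    newly : ∀ {k} → (_ , inj₂ k) ∈ _ → k ∈Hasco settle co _ _ H
    -- `Live` guarantees that the entry is still an action, the only status that `resolve` turns
    -- into `co`.
    newly q with live (closing-exposed co s) q
    ... | i , a , p = i , settle-related H p (IsConfig.E-sym v q)
  coEq-step⁺ v live (commitⁱ {H = H} _ _) (inj₁ (h , h′ , r)) = hasco-settle⁺ H h , hasco-settle⁺ H h′ , r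
  coEq-step⁺ v live (abort {H = H} _) (inj₁ (h , h′ , r)) = hasco-settle⁺ H h , hasco-settle⁺ H h′ , r
  coEq-step⁺ v live (kact _ _ (closed , _) _) (inj₁ ((i , h) , (i′ , h′) , r)) =
    (i , there h) , (i′ , there h′) , ClosedUnder.extends closed r
  coEq-step⁺ v live (kabort _ _ _) (inj₁ ((i , h) , (i′ , h′) , r)) =
    (i , there h) , (i′ , there h′) , there r

  coEq-step⁻ : ∀ {ζ C D k k′} → IsConfig C → Live C → Step commit-sensitive C ζ D →
               CoEq D k k′ → CoEq C k k′ ⊎ (k ∈ committed ζ × k′ ∈ committed ζ)
  coEq-step⁻ v live (tau _) c = inj₁ c
  coEq-step⁻ v live (ktau s f m) (h , h′ , r) = inj₁ (h , h′ , coEq-merge⁻ v live s refl f m h r)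
  coEq-step⁻ v live (start _ _) c = inj₁ c
  coEq-step⁻ v live (commitᵉ {H = H} s K _) (h , h′ , r) with hasco-settle-co H h | hasco-settle-co H h′
  ... | inj₁ g | inj₁ g′ = inj₁ (g , g′ , r)
  -- One name in the committed class is enough: `r` brings the other one into the same class.
  ... | inj₂ q | _       = inj₂ ( Equivalence.from (K _) (E-sym q)
                                , Equivalence.from (K _) (E-trans (E-sym q) r))
    where open IsConfig v
  ... | inj₁ _ | inj₂ q  = inj₂ ( Equivalence.from (K _) (E-sym (E-trans r q))
                                , Equivalence.from (K _) (E-sym q))
    where open IsConfig v
  coEq-step⁻ v live (commitⁱ {H = H} s K) (h , h′ , r) = inj₁ (old h , old h′ , r)
    where
    old : ∀ {k} → k ∈Hasco settle co _ _ H → k ∈Hasco H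
    old h with hasco-settle-co H h
    ... | inj₁ g = g
    ... | inj₂ q with () ← Equivalence.from (K _) (IsConfig.E-sym v q)
  coEq-step⁻ v live (abort {H = H} s) (h , h′ , r) = inj₁ (hasco-settle-ab H h , hasco-settle-ab H h′ , r)
  coEq-step⁻ v live (kact s f m _) ((i , there h) , (i′ , there h′) , r) =
    inj₁ ((i , h) , (i′ , h′) , coEq-merge⁻ v live s refl f m (i , h) r)
  coEq-step⁻ v live (kabort f _ _) ((i , there h) , (i′ , there h′) , here refl) =
    contradiction (i , co , h) (Fresh.H-fresh f refl)
  coEq-step⁻ v live (kabort f _ _) ((i , there h) , (i′ , there h′) , there r) =
    inj₁ ((i , h) , (i′ , h′) , r)

  -- By `Live` the members of K are pending beforehand. Together with `coEq-step⁺` this makes every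
  -- labelled commit a visible change of the committed names.
  commit-new : ∀ {C D K k} → IsConfig C → Live C → Step commit-sensitive C (co K) D → k ∈ K →
               ¬ k ∈Hasco RawConfig.hist C
  commit-new v live (commitᵉ s K _) k∈ =
    pending⇒¬hasco v (live (closing-exposed co s) (Equivalence.to (K _) k∈))

  commit-related : ∀ {C D K k k′} → IsConfig C → Step commit-sensitive C (co K) D → k ∈ K → k′ ∈ K →
                   (inj₂ k , inj₂ k′) ∈ RawConfig.eqv C
  commit-related v (commitᵉ _ K _) k∈ k′∈ =
    IsConfig.E-trans v (IsConfig.E-sym v (Equivalence.to (K _) k∈)) (Equivalence.to (K _) k′∈)

  commit-nonempty : ∀ {C D K} → Step commit-sensitive C (co K) D → ∃[ k ] k ∈ K
  commit-nonempty {K = []} (commitᵉ _ _ ne)    = contradiction refl ne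
  commit-nonempty {K = k ∷ _} (commitᵉ _ _ ne) = k , here refl

  -- Both the rule and the modality `⟨co⟩` determine K only as a set, whereas the label is a list.
  relabel : ∀ {C D K K′} → (∀ k → k ∈ K ⇔ k ∈ K′) → Step commit-sensitive C (co K) D →
            Step commit-sensitive C (co K′) D
  relabel {K = K} same st@(commitᵉ s L ne) =
    commitᵉ s (λ k → mk⇔ (Equivalence.to (L k) ∘ Equivalence.from (same k))
                         (Equivalence.to (same k) ∘ Equivalence.from (L k)))
              (λ { refl → case-empty (Equivalence.to (same _) (proj₂ (commit-nonempty st))) })
    where
    case-empty : ∀ {k : exTrN} → ¬ (k ∈ [])
    case-empty ()

  -- Passing between the extended and the commit-sensitive semantics

  erase : ExtLabel → ExtLabel
  erase (co K) = τ
  erase ζ      = ζ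

  forget : ∀ {C D ζ} → Step commit-sensitive C ζ D → Step extended C (erase ζ) D
  forget (tau s)         = tau s
  forget (ktau s f m)    = ktau s f m
  forget (start s f)     = start s f
  forget (commitᵉ s _ _) = commit s
  forget (commitⁱ s _)   = commit s
  forget (abort s)       = abort s
  forget (kact s f m i)  = kact s f m i
  forget (kabort f n i)  = kabort f n i

  -- An external name related to `k` is related to itself, and so occurs in the history by
  -- `E-external`; hence it is enough to filter the names of H.
  externals : ∀ {E H P} → IsConfig ⟨ E ⨾ H ∙ P ⟩ → ∀ k → ∃[ K ] K Lists E ext k
  externals {E} {H} v k = filter related? names , λ k′ → mk⇔
    (λ k′∈ → proj₂ (∈-filter⁻ related? {xs = names} k′∈))
    (λ r → ∈-filter⁺ related? (named r) r)
    where
    open IsConfig v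
    names = map (proj₁ ∘ proj₂) H
    related? = λ k′ → (k , inj₂ k′) ∈ᵖ? E
    named : ∀ {k′} → (k , inj₂ k′) ∈ E → k′ ∈ names
    named r with Equivalence.to (E-external _) (E-trans (E-sym r) r)
    ... | _ , _ , h = ∈-map⁺ (proj₁ ∘ proj₂) h

  sensitise : ∀ {C D ζ} → IsConfig C → Step extended C ζ D →
              ∃[ ζ′ ] Step commit-sensitive C ζ′ D × erase ζ′ ≡ ζ
  sensitise v (tau s)        = _ , tau s , refl
  sensitise v (ktau s f m)   = _ , ktau s f m , refl
  sensitise v (start s f)    = _ , start s f , refl
  sensitise v (commit {k = k} s) with externals v k
  ... | []    , L = _ , commitⁱ s L , refl
  ... | _ ∷ _ , L = _ , commitᵉ s L (λ ()) , refl
  sensitise v (abort s)      = _ , abort s , refl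
  sensitise v (kact s f m i) = _ , kact s f m i , refl
  sensitise v (kabort f n i) = _ , kabort f n i , refl

  -- Renaming external names

  -- Renamings are involutions, in the end transpositions, so that π is its own inverse: membership
  -- in a renamed list is membership of the image, and each preservation result also serves as its
  -- converse.
  module Renaming (π : exTrN → exTrN) (π-involutive : ∀ k → π (π k) ≡ k) where

    module Ext = Involution π π-involutive

    πᵗ : TrN → TrN
    πᵗ = Sum.map₂ π

    πᵗ-involutive : ∀ k → πᵗ (πᵗ k) ≡ k
    πᵗ-involutive (inj₁ k) = refl
    πᵗ-involutive (inj₂ k) = cong inj₂ (π-involutive k)

    module Trn = Involution πᵗ πᵗ-involutive

    πᵖ : TrN × TrN → TrN × TrN
    πᵖ (k , l) = πᵗ k , πᵗ l

    πᵖ-involutive : ∀ p → πᵖ (πᵖ p) ≡ p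
    πᵖ-involutive (k , l) = cong₂ _,_ (πᵗ-involutive k) (πᵗ-involutive l)

    module Pair = Involution πᵖ πᵖ-involutive

    πᵉ : ℕ × exTrN × Status → ℕ × exTrN × Status
    πᵉ (i , k , s) = i , π k , s

    πᵉ-involutive : ∀ e → πᵉ (πᵉ e) ≡ e
    πᵉ-involutive (i , k , s) = cong (λ k → i , k , s) (π-involutive k)

    module Entry = Involution πᵉ πᵉ-involutive

    renE : Eqv → Eqv
    renE = map πᵖ

    renH : Hist → Hist
    renH = map πᵉ

    -- Like _⟨_⟩, this reaches every name of a well-named process.
    renP : ∀ {m n} → Term m n → Term m n
    renP (P ∣ Q)        = renP P ∣ renP Q
    renP (ν P)          = ν (renP P)
    renP ⟦ P ▷[ k ] Q ⟧ = ⟦ P ▷[ πᵗ k ] Q ⟧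
    renP P              = P

    renS : Subst → Subst
    renS ε        = ε
    renS (ks ↦ l) = map πᵗ ks ↦ πᵗ l

    renL : ∀ {m} → Label m → Label m
    renL (plain μ) = plain μ
    renL (k ⦅ μ ⦆) = πᵗ k ⦅ μ ⦆

    renR : Reconf → Reconf
    renR (co k)  = co (πᵗ k)
    renR (ab k)  = ab (πᵗ k)
    renR (new k) = new (πᵗ k)

    renZ : ExtLabel → ExtLabel
    renZ τ         = τ
    renZ (k ⦅ a ⦆) = π k ⦅ a ⦆
    renZ (co K)    = co (map π K)

    renC : RawConfig → RawConfig
    renC ⟨ E ⨾ H ∙ P ⟩ = ⟨ renE E ⨾ renH H ∙ renP P ⟩

    renP-involutive : ∀ {m n} (T : Term m n) → renP (renP T) ≡ T
    renP-involutive (∑ J μ P)      = refl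
    renP-involutive (P ∣ Q)        = cong₂ _∣_ (renP-involutive P) (renP-involutive Q)
    renP-involutive (ν P)          = cong ν (renP-involutive P)
    renP-involutive (var X)        = refl
    renP-involutive (rec P)        = refl
    renP-involutive ⟦ P ▷[ k ] Q ⟧ = cong (λ k → ⟦ P ▷[ k ] Q ⟧) (πᵗ-involutive k)
    renP-involutive co             = refl
    renP-involutive ⟦ P ▶ Q ⟧      = refl

    renC-involutive : ∀ C → renC (renC C) ≡ C
    renC-involutive ⟨ E ⨾ H ∙ P ⟩
      rewrite Pair.map-involutive E | Entry.map-involutive H | renP-involutive P = refl

    -- Transitions bring to the surface subterms that `renP` does not enter: summands, unfoldings,
    -- bodies and alternatives of transactions. These are nameless, so renaming them after the step
    -- agrees with not having renamed them before.
    renP-nameless : ∀ {m n} (T : Term m n) → Nameless T → renP T ≡ T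
    renP-nameless (∑ J μ P) p     = refl
    renP-nameless (P ∣ Q) (p , q) = cong₂ _∣_ (renP-nameless P p) (renP-nameless Q q)
    renP-nameless (ν P) p         = cong ν (renP-nameless P p)
    renP-nameless (var X) p       = refl
    renP-nameless (rec P) p       = refl
    renP-nameless co p            = refl
    renP-nameless ⟦ P ▶ Q ⟧ p     = refl

    wellPlaced-ren : ∀ {m n} (T : Term m n) → WellPlaced T → WellPlaced (renP T)
    wellPlaced-ren (∑ J μ P) w      = w
    wellPlaced-ren (P ∣ Q) (w , v)  = wellPlaced-ren P w , wellPlaced-ren Q v
    wellPlaced-ren (ν P) w          = wellPlaced-ren P w
    wellPlaced-ren (var X) w        = w
    wellPlaced-ren (rec P) w        = w
    wellPlaced-ren ⟦ P ▷[ k ] Q ⟧ w = w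
    wellPlaced-ren co w             = w
    wellPlaced-ren ⟦ P ▶ Q ⟧ w      = w

    exposed-ren : ∀ {m n k} (T : Term m n) → Exposed k (renP T) → Exposed (πᵗ k) T
    exposed-ren (P ∣ Q) (inj₁ e)           = inj₁ (exposed-ren P e)
    exposed-ren (P ∣ Q) (inj₂ e)           = inj₂ (exposed-ren Q e)
    exposed-ren (ν P) e                    = exposed-ren P e
    exposed-ren ⟦ P ▷[ k ] Q ⟧ refl        = πᵗ-involutive k

    ∈ftn-ren : ∀ {m n k} (T : Term m n) → WellPlaced T → k ∈ftn renP T → πᵗ k ∈ftn T
    ∈ftn-ren T w k∈ = exposed⇒∈ftn T (exposed-ren T (∈ftn⇒exposed (wellPlaced-ren T w) k∈))

    ♯-ren : ∀ {m n k} (T : Term m n) → WellPlaced T → k ♯ T → πᵗ k ♯ renP T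
    ♯-ren T w k♯T k∈ = k♯T (subst (_∈ftn T) (πᵗ-involutive _) (∈ftn-ren T w k∈))

    range-ren : ∀ σ → range (renS σ) ≡ map πᵗ (range σ)
    range-ren ε        = refl
    range-ren (ks ↦ l) = refl

    dom-ren : ∀ σ → dom (renS σ) ≡ map πᵗ (dom σ)
    dom-ren ε        = refl
    dom-ren (ks ↦ l) = refl

    apply-ren : ∀ σ k → apply (renS σ) (πᵗ k) ≡ πᵗ (apply σ k)
    apply-ren ε k = refl
    apply-ren (ks ↦ l) k with πᵗ k ∈ᵗ? map πᵗ ks | k ∈ᵗ? ks
    ... | yes _  | yes _  = refl
    ... | no _   | no _   = refl
    ... | yes k∈ | no k∉  = contradiction (Trn.∈-map-cancel k∈) k∉
    ... | no k∉  | yes k∈ = contradiction (∈-map⁺ πᵗ k∈) k∉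

    ⟨⟩-ren : ∀ {m n} σ (T : Term m n) → renP T ⟨ renS σ ⟩ ≡ renP (T ⟨ σ ⟩)
    ⟨⟩-ren σ (∑ J μ P)      = refl
    ⟨⟩-ren σ (P ∣ Q)        = cong₂ _∣_ (⟨⟩-ren σ P) (⟨⟩-ren σ Q)
    ⟨⟩-ren σ (ν P)          = cong ν (⟨⟩-ren σ P)
    ⟨⟩-ren σ (var X)        = refl
    ⟨⟩-ren σ (rec P)        = refl
    ⟨⟩-ren σ ⟦ P ▷[ k ] Q ⟧ = cong (λ k → ⟦ P ▷[ k ] Q ⟧) (apply-ren σ k)
    ⟨⟩-ren σ co             = refl
    ⟨⟩-ren σ ⟦ P ▶ Q ⟧      = refl

    range-♯-ren : ∀ {m n} σ (T : Term m n) → WellPlaced T → (∀ {k} → k ∈ range σ → k ♯ T) →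
                  ∀ {k} → k ∈ range (renS σ) → k ♯ renP T
    range-♯-ren σ T w f k∈ k∈T =
      f (Trn.∈-map⇒ (subst (_ ∈_) (range-ren σ) k∈)) (∈ftn-ren T w k∈T)

    weaken-ren : ∀ {m} (α : Label m) → renL (weaken α) ≡ weaken (renL α)
    weaken-ren (plain μ) = refl
    weaken-ren (k ⦅ μ ⦆) = refl

    move-ren : ∀ {m α σ} {P Q : Term m 0} → WellPlaced P → P —[ α , σ ]→ Q →
               renP P —[ renL α , renS σ ]→ renP Q
    move-ren w (sum {P = P} j) rewrite renP-nameless (P j) (w j) = sum j
    move-ren (w , v) (com s t) = com (move-ren w s) (move-ren v t)
    move-ren w (rec {P}) rewrite renP-nameless (P [ rec P /X]) (nameless-unfold P {rec P} w w) = rec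
    move-ren w (tsum j eq) = tsum j eq
    move-ren w (trun s k≢l) = trun s (k≢l ∘ Trn.injective)
    move-ren (w , v) (tcom {P′ = P′} {Q′ = Q′} {k = k} {ls₁ = ls₁} {ls₂ = ls₂} s t)
      rewrite map-++ πᵗ ls₁ ls₂ | sym (⟨⟩-ren (ls₂ ↦ k) P′) | sym (⟨⟩-ren (ls₁ ↦ k) Q′) =
      tcom (move-ren w s) (move-ren v t)
    move-ren (w , v) (parˡ {Q = Q} {σ = σ} s f) rewrite sym (⟨⟩-ren σ Q) =
      parˡ (move-ren w s) (range-♯-ren σ Q v f)
    move-ren (w , v) (parʳ {P = P} {σ = σ} s f) rewrite sym (⟨⟩-ren σ P) =
      parʳ (move-ren v s) (range-♯-ren σ P w f)
    move-ren w (res {P} {P′} {α} {σ} s) =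
      res (subst (λ α → renP P —[ α , renS σ ]→ renP P′) (weaken-ren α) (move-ren w s))

    trn-ren : ∀ β → trn (renR β) ≡ πᵗ (trn β)
    trn-ren (co k)  = refl
    trn-ren (ab k)  = refl
    trn-ren (new k) = refl

    trn-♯-ren : ∀ {m n} β (T : Term m n) → WellPlaced T → trn β ♯ T → trn (renR β) ♯ renP T
    trn-♯-ren β T w f = subst (_♯ renP T) (sym (trn-ren β)) (♯-ren T w f)

    reconf-ren : ∀ {m β} {P Q : Term m 0} → WellPlaced P → P —[ β ]→ʳ Q →
                 renP P —[ renR β ]→ʳ renP Q
    reconf-ren (p , q) (commit {P′ = P′} eq r) rewrite renP-nameless P′ (nameless-⇝co r p) = commit eq r
    reconf-ren w start = start
    reconf-ren (p , q) (abort {Q = Q}) rewrite renP-nameless Q q = abort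
    reconf-ren (w , v) (parco s t) = parco (reconf-ren w s) (reconf-ren v t)
    reconf-ren (w , v) (parab s t) = parab (reconf-ren w s) (reconf-ren v t)
    reconf-ren (w , v) (parˡ {Q = Q} {β} s f) = parˡ (reconf-ren w s) (trn-♯-ren β Q v f)
    reconf-ren (w , v) (parʳ {P = P} {β = β} s f) = parʳ (reconf-ren v s) (trn-♯-ren β P w f)
    reconf-ren w (res s) = res (reconf-ren w s)

    hasco-ren⇒ : ∀ {k H} → k ∈Hasco renH H → π k ∈Hasco H
    hasco-ren⇒ (i , h) = i , Entry.∈-map⇒ h

    hasco-ren⇐ : ∀ {k H} → π k ∈Hasco H → k ∈Hasco renH H
    hasco-ren⇐ (i , h) = i , Entry.∈-map⇐ h

    htrn-ren⇒ : ∀ {k H} → k ∈Htrn renH H → π k ∈Htrn H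
    htrn-ren⇒ (i , s , h) = i , s , Entry.∈-map⇒ h

    htrn-ren⇐ : ∀ {k H} → π k ∈Htrn H → k ∈Htrn renH H
    htrn-ren⇐ (i , s , h) = i , s , Entry.∈-map⇐ h

    isConfig-ren : ∀ {C} → IsConfig C → IsConfig (renC C)
    isConfig-ren {⟨ E ⨾ H ∙ P ⟩} v = record
      { wellNamed  = wellPlaced⇒wellNamed (renP P) (wellPlaced-ren P (wellPlaced v))
      ; E-sym      = λ r → Pair.∈-map⇐ (E-sym (Pair.∈-map⇒ r))
      ; E-trans    = λ r q → Pair.∈-map⇐ (E-trans (Pair.∈-map⇒ r) (Pair.∈-map⇒ q))
      ; H-function = λ h h′ → entry-cong (H-function (Entry.∈-map⇒ h) (Entry.∈-map⇒ h′))
      ; H-unique   = λ h h′ → H-unique (Entry.∈-map⇒ h) (Entry.∈-map⇒ h′)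
      ; E-external = λ k → mk⇔
          (htrn-ren⇐ ∘ Equivalence.to (E-external (π k)) ∘ Pair.∈-map⇒)
          (Pair.∈-map⇐ ∘ Equivalence.from (E-external (π k)) ∘ htrn-ren⇒)
      ; E-hasco    = λ r → let eq = E-hasco (Pair.∈-map⇒ r) in mk⇔
          (hasco-ren⇐ ∘ Equivalence.to eq ∘ hasco-ren⇒)
          (hasco-ren⇐ ∘ Equivalence.from eq ∘ hasco-ren⇒)
      ; P-hasco    = λ k∈ h → P-hasco (∈ftn-ren P (wellPlaced v) k∈) (hasco-ren⇒ h)
      ; P-distinct = λ r k∈ l∈ → Trn.injective
          (P-distinct (Pair.∈-map⇒ r) (∈ftn-ren P (wellPlaced v) k∈) (∈ftn-ren P (wellPlaced v) l∈))
      ; P-external = λ k∈ → htrn-ren⇐ (P-external (∈ftn-ren P (wellPlaced v) k∈))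
      }
      where
      open IsConfig v
      entry-cong : ∀ {k l : exTrN} {s t : Status} → (π k , s) ≡ (π l , t) → (k , s) ≡ (l , t)
      entry-cong eq = cong₂ _,_ (Ext.injective (cong proj₁ eq)) (cong proj₂ eq)

    fresh-ren : ∀ {k E H} → Fresh k E H → Fresh (πᵗ k) (renE E) (renH H)
    fresh-ren {k} f = record
      { E-freshˡ = λ {l} r → E-freshˡ (subst (λ k → (k , πᵗ l) ∈ _) (πᵗ-involutive k) (Pair.∈-map⇒ r))
      ; E-freshʳ = λ {l} r → E-freshʳ (subst (λ k → (πᵗ l , k) ∈ _) (πᵗ-involutive k) (Pair.∈-map⇒ r))
      ; H-fresh  = λ eq h → H-fresh (trans (sym (πᵗ-involutive k)) (cong πᵗ eq)) (htrn-ren⇒ h)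
      }
      where open Fresh f

    closed-ren : ∀ {σ E F} → ClosedUnder σ E F → ClosedUnder (renS σ) (renE E) (renE F)
    closed-ren {σ} c = record
      { sym     = λ r → Pair.∈-map⇐ (F-sym (Pair.∈-map⇒ r))
      ; trans   = λ r q → Pair.∈-map⇐ (F-trans (Pair.∈-map⇒ r) (Pair.∈-map⇒ q))
      ; extends = λ r → Pair.∈-map⇐ (extends (Pair.∈-map⇒ r))
      ; target  = λ l∈ → Pair.∈-map⇐ (target (in-range l∈))
      ; merges  = λ k∈ l∈ → Pair.∈-map⇐
                  (merges (Trn.∈-map⇒ (subst (_ ∈_) (dom-ren σ) k∈)) (in-range l∈))
      }
      where
      open ClosedUnder c renaming (sym to F-sym; trans to F-trans)
      in-range : ∀ {l} → l ∈ range (renS σ) → πᵗ l ∈ range σ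
      in-range l∈ = Trn.∈-map⇒ (subst (_ ∈_) (range-ren σ) l∈)

    renS-involutive : ∀ σ → renS (renS σ) ≡ σ
    renS-involutive ε        = refl
    renS-involutive (ks ↦ l) = cong₂ _↦_ (Trn.map-involutive ks) (πᵗ-involutive l)

    merge-ren : ∀ {σ E F} → σ ⟪ E ⟫= F → renS σ ⟪ renE E ⟫= renE F
    -- For minimality, a closed relation on the renamed side is pulled back by the same renaming and
    -- compared there with F.
    merge-ren {σ} {E} (closed , least) = closed-ren closed , λ F′ c′ r →
      Pair.∈-map-cancel (least (renE F′)
        (subst₂ (λ σ E → ClosedUnder σ E (renE F′)) (renS-involutive σ) (Pair.map-involutive E)
                (closed-ren c′))
        (Pair.∈-map⇒ r))

    settle-ren : ∀ s E k H → renH (settle s E k H) ≡ settle s (renE E) (πᵗ k) (renH H)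
    settle-ren s E k [] = refl
    settle-ren s E k ((i , k′ , s′) ∷ H)
      with (inj₂ k′ , k) ∈ᵖ? E | (inj₂ (π k′) , πᵗ k) ∈ᵖ? renE E
    ... | yes _ | yes _ = cong (_ ∷_) (settle-ren s E k H)
    ... | no _  | no _  = cong (_ ∷_) (settle-ren s E k H)
    ... | yes r | no ¬r = contradiction (∈-map⁺ πᵖ r) ¬r
    ... | no ¬r | yes r = contradiction (Pair.∈-map-cancel r) ¬r

    index-ren : ∀ {i H} → (∀ {e} → (i , e) ∉ H) → ∀ {e} → (i , e) ∉ renH H
    index-ren f h = f (Entry.∈-map⇒ h)

    lists-ren : ∀ {K E k} → K Lists E ext k → map π K Lists renE E ext πᵗ k
    lists-ren {K} {E} {k} L k′ = mk⇔
      (λ k∈ → Pair.∈-map⇐ (subst (λ k → (k , inj₂ (π k′)) ∈ E) (sym (πᵗ-involutive k))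
                            (Equivalence.to (L (π k′)) (Ext.∈-map⇒ k∈))))
      (λ r → Ext.∈-map⇐ (Equivalence.from (L (π k′))
               (subst (λ k → (k , inj₂ (π k′)) ∈ E) (πᵗ-involutive k) (Pair.∈-map⇒ r))))

    map-≢[] : ∀ {K : List exTrN} → K ≢ [] → map π K ≢ []
    map-≢[] {[]} ne = λ _ → ne refl
    map-≢[] {_ ∷ _} ne ()

    step-ren : ∀ {s C ζ D} → IsConfig C → Step s C ζ D → Step s (renC C) (renZ ζ) (renC D)
    step-ren v (tau s)      = tau (move-ren (wellPlaced v) s)
    step-ren v (ktau s f m) = ktau (move-ren (wellPlaced v) s) (fresh-ren f) (merge-ren m)
    step-ren v (start s f)  = start (reconf-ren (wellPlaced v) s) (fresh-ren f)
    step-ren v (commit {E = E} {H} {k = k} s) rewrite settle-ren co E k H =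
      commit (reconf-ren (wellPlaced v) s)
    step-ren v (commitᵉ {E = E} {H} {k = k} s L ne) rewrite settle-ren co E k H =
      commitᵉ (reconf-ren (wellPlaced v) s) (lists-ren L) (map-≢[] ne)
    step-ren v (commitⁱ {E = E} {H} {k = k} s L) rewrite settle-ren co E k H =
      commitⁱ (reconf-ren (wellPlaced v) s) (lists-ren L)
    step-ren v (abort {E = E} {H} {k = k} s) rewrite settle-ren ab E k H =
      abort (reconf-ren (wellPlaced v) s)
    step-ren v (kact s f m i) =
      kact (move-ren (wellPlaced v) s) (fresh-ren f) (merge-ren m) (index-ren i)
    step-ren v (kabort {P = P} f n i) =
      kabort (fresh-ren f) (♯-ren P (wellPlaced v) n) (index-ren i)

  -- Satisfaction is invariant under renaming

  IsVariable : ∀ {n} → Ref n → Set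
  IsVariable (inj₁ _) = ⊥
  IsVariable (inj₂ _) = ⊤

  -- An infinitary formula may mention every external name, and is then altered
  -- by every renaming.  Without constants it is altered by none.
  ConstantFree : ∀ {ℒ n} → Formula ℒ n → Set
  ConstantFree (⟨τ⟩ φ)      = ConstantFree φ
  ConstantFree (⟨x⦅ a ⦆⟩ φ) = ConstantFree φ
  ConstantFree (¬′ φ)       = ConstantFree φ
  ConstantFree (⋀ M φ)      = ∀ i → ConstantFree (φ i)
  ConstantFree (Hasco v)    = IsVariable v
  ConstantFree (v =co w)    = IsVariable v × IsVariable w
  ConstantFree (⟨co⟩ K _ φ) = (∀ {v} → K v → IsVariable v) × ConstantFree φ

  module RenamingSat (π : exTrN → exTrN) (π-involutive : ∀ k → π (π k) ≡ k) where
    open Renaming π π-involutive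

    -- Only the raw parts are equated: two proofs of validity need not be equal.
    Renames : Config → Config → Set
    Renames C D = Config.raw D ≡ renC (Config.raw C)

    renames-sym : ∀ {C D} → Renames C D → Renames D C
    renames-sym {C} eq = trans (sym (renC-involutive (Config.raw C))) (cong renC (sym eq))

    renConfig : Config → Config
    renConfig (config C v) = config (renC C) (isConfig-ren v)

    step-renames : ∀ {C D C′ s ζ} → Renames C D → C —[ s ∣ ζ ]→ C′ →
                   D —[ s ∣ renZ ζ ]→ renConfig C′
    step-renames {C} eq st =
      subst (λ D → Step _ D _ _) (sym eq) (step-ren (Config.valid C) st)

    star-renames : ∀ {C D C′ s} → Renames C D → C =[ s ∣τ]⇒ C′ →
                   ∃[ D′ ] D =[ s ∣τ]⇒ D′ × Renames C′ D′
    star-renames eq ε = _ , ε , eq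
    star-renames {C} {D} eq (_◅_ {j = C₁} st sts) with star-renames {C₁} {renConfig C₁} refl sts
    ... | D′ , sts′ , eq′ = D′ , step-renames {C} {D} {C₁} eq st ◅ sts′ , eq′

    weak-renames : ∀ {C D C′ s ζ} → Renames C D → C =[ s ∣ ζ ]⇒ C′ →
                   ∃[ D′ ] D =[ s ∣ renZ ζ ]⇒ D′ × Renames C′ D′
    weak-renames {C} {D} eq (C₁ , C₂ , sts₁ , st , sts₂) with star-renames {C} {D} eq sts₁
    ... | D₁ , sts₁′ , eq₁ with star-renames {C₂} {renConfig C₂} refl sts₂
    ... | D′ , sts₂′ , eq₂ =
      D′ , (D₁ , renConfig C₂ , sts₁′ , step-renames {C₁} {D₁} {C₂} eq₁ st , sts₂′) , eq₂

    inst-ren : ∀ {n} {ρ ρ′ : Env n} (v : Ref n) → IsVariable v → (∀ x → ρ′ x ≡ π (ρ x)) →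
               inst ρ′ v ≡ π (inst ρ v)
    inst-ren (inj₂ x) _ eqs = eqs x

    inst-ren⇐ : ∀ {n} {ρ ρ′ : Env n} (v : Ref n) → IsVariable v → (∀ x → ρ′ x ≡ π (ρ x)) →
                π (inst ρ′ v) ≡ inst ρ v
    inst-ren⇐ v c eqs = trans (cong π (inst-ren v c eqs)) (π-involutive _)

    -- The environment is renamed along with the configuration, so each variable keeps its referent.
    -- Negation needs the reverse implication, which is the same statement because π is an
    -- involution.
    sat-renames : ∀ {ℒ n} (φ : Formula ℒ n) {C D ρ ρ′} → ConstantFree φ → Renames C D →
                  (∀ x → ρ′ x ≡ π (ρ x)) → Sat C φ ρ → Sat D φ ρ′
    sat-renames (⟨τ⟩ φ) {C} {D} c eq eqs (C′ , w , sat) with star-renames {C} {D} eq w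
    ... | D′ , w′ , eq′ = D′ , w′ , sat-renames φ c eq′ eqs sat
    sat-renames {ℒ} (⟨x⦅ a ⦆⟩ φ) {C} {D} {ρ} {ρ′} c eq eqs (N , sat) = map π N , sat′
      where
      sat′ : ∀ l → l ∉ map π N →
             ∃[ D′ ] D =[ semantics ℒ ∣ l ⦅ a ⦆ ]⇒ D′ × Sat D′ φ (l ◂ ρ′)
      sat′ l l∉ with sat (π l) (l∉ ∘ Ext.∈-map⇐)
      ... | C′ , w , satC′ with weak-renames {C} {D} eq w
      ... | D′ , w′ , eq′ = D′ ,
        subst (λ l → D =[ semantics ℒ ∣ l ⦅ a ⦆ ]⇒ D′) (π-involutive l) w′ ,
        sat-renames φ c eq′ (λ { zero → sym (π-involutive l) ; (suc x) → eqs x }) satC′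
    sat-renames (¬′ φ) {C} {D} c eq eqs ¬sat sat =
      ¬sat (sat-renames φ {D} {C} c (renames-sym {C} {D} eq)
             (λ x → trans (sym (π-involutive _)) (cong π (sym (eqs x)))) sat)
    sat-renames (⋀ M φ) c eq eqs sat i = sat-renames (φ i) (c i) eq eqs (sat i)
    sat-renames (Hasco v) c refl eqs h = hasco-ren⇐ (subst (_∈Hasco _) (sym (inst-ren⇐ v c eqs)) h)
    sat-renames (v =co w) {config ⟨ E ⨾ H ∙ P ⟩ _} (c , d) refl eqs (h , g , r) =
      hasco-ren⇐ (subst (_∈Hasco H) (sym (inst-ren⇐ v c eqs)) h) ,
      hasco-ren⇐ (subst (_∈Hasco H) (sym (inst-ren⇐ w d eqs)) g) ,
      Pair.∈-map⇐ (subst₂ (λ k l → (inj₂ k , inj₂ l) ∈ E)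
                          (sym (inst-ren⇐ v c eqs)) (sym (inst-ren⇐ w d eqs)) r)
    sat-renames (⟨co⟩ K _ φ) {C} {D} {ρ} {ρ′} (cK , c) eq eqs (ks , (to , from) , C′ , w , sat)
      with weak-renames {C} {D} eq w
    ... | D′ , w′ , eq′ = map π ks , (to′ , from′) , D′ , w′ , sat-renames φ c eq′ eqs sat
      where
      to′ : ∀ {k} → k ∈ map π ks → instSet ρ′ K k
      to′ k∈ with to (Ext.∈-map⇒ k∈)
      ... | v , Kv , eqv = v , Kv ,
        trans (inst-ren v (cK Kv) eqs) (trans (cong π eqv) (π-involutive _))
      from′ : ∀ {k} → instSet ρ′ K k → k ∈ map π ks
      from′ (v , Kv , refl) = Ext.∈-map⇐ (from (v , Kv , sym (inst-ren⇐ v (cK Kv) eqs)))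

    renP-fixed : ∀ {m n} (T : Term m n) → (∀ {k} → Exposed k T → πᵗ k ≡ k) → renP T ≡ T
    renP-fixed (∑ J μ P) f      = refl
    renP-fixed (P ∣ Q) f        = cong₂ _∣_ (renP-fixed P (f ∘ inj₁)) (renP-fixed Q (f ∘ inj₂))
    renP-fixed (ν P) f          = cong ν (renP-fixed P f)
    renP-fixed (var X) f        = refl
    renP-fixed (rec P) f        = refl
    renP-fixed ⟦ P ▷[ k ] Q ⟧ f = cong (λ k → ⟦ P ▷[ k ] Q ⟧) (f refl)
    renP-fixed co f             = refl
    renP-fixed ⟦ P ▶ Q ⟧ f      = refl

    -- By `E-external` and `P-external` the history contains every external name of the
    -- configuration.
    renames-fixed : ∀ C → (∀ {k} → k ∈Htrn Config.hist C → π k ≡ k) → Renames C C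
    renames-fixed (config ⟨ E ⨾ H ∙ P ⟩ v) fixed = raw-cong
      (sym (map-id-local (All.tabulate pair-fixed)))
      (sym (map-id-local (All.tabulate λ h → cong (λ k → _ , k , _) (fixed (_ , _ , h)))))
      (sym (renP-fixed P exposed-fixed))
      where
      open IsConfig v
      raw-cong : ∀ {E E′ H H′ P P′} → E ≡ E′ → H ≡ H′ → P ≡ P′ →
                 ⟨ E ⨾ H ∙ P ⟩ ≡ ⟨ E′ ⨾ H′ ∙ P′ ⟩
      raw-cong refl refl refl = refl
      related-fixed : ∀ {k l} → (k , l) ∈ E → πᵗ k ≡ k
      related-fixed {inj₁ _} _ = refl
      related-fixed {inj₂ k} r = cong inj₂ (fixed (Equivalence.to (E-external k) (E-trans r (E-sym r))))
      pair-fixed : ∀ {p} → p ∈ E → πᵖ p ≡ p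
      pair-fixed r = cong₂ _,_ (related-fixed r) (related-fixed (E-sym r))
      exposed-fixed : ∀ {k} → Exposed k P → πᵗ k ≡ k
      exposed-fixed {inj₁ _} _ = refl
      exposed-fixed {inj₂ k} e = cong inj₂ (fixed (P-external (exposed⇒∈ftn P e)))

  -- Exchanging fresh names

  transpose : exTrN → exTrN → exTrN → exTrN
  transpose l l′ k with k ≟ᵉ l | k ≟ᵉ l′
  ... | yes _ | _     = l′
  ... | no _  | yes _ = l
  ... | no _  | no _  = k

  transposeˡ : ∀ l l′ → transpose l l′ l ≡ l′
  transposeˡ l l′ with l ≟ᵉ l | l ≟ᵉ l′
  ... | yes _ | _ = refl
  ... | no ¬p | _ = contradiction refl ¬p

  transposeʳ : ∀ l l′ → transpose l l′ l′ ≡ l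
  transposeʳ l l′ with l′ ≟ᵉ l | l′ ≟ᵉ l′
  ... | yes p | _     = p
  ... | no _  | yes _ = refl
  ... | no _  | no ¬p = contradiction refl ¬p

  transpose-≢ : ∀ {l l′ k} → k ≢ l → k ≢ l′ → transpose l l′ k ≡ k
  transpose-≢ {l} {l′} {k} k≢l k≢l′ with k ≟ᵉ l | k ≟ᵉ l′
  ... | yes p | _     = contradiction p k≢l
  ... | no _  | yes p = contradiction p k≢l′
  ... | no _  | no _  = refl

  transpose-involutive : ∀ l l′ k → transpose l l′ (transpose l l′ k) ≡ k
  transpose-involutive l l′ k with k ≟ᵉ l | k ≟ᵉ l′
  ... | yes refl | _        = transposeʳ k l′
  ... | no _     | yes refl = transposeˡ l k
  ... | no k≢l   | no k≢l′  = transpose-≢ k≢l k≢l′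

  fresh-name : (N : List exTrN) → ∃[ l ] l ∉ N
  fresh-name N with em 0ℓ {∃[ l ] l ∉ N}
  ... | yes p   = p
  ... | no none = contradiction
    (λ i → decidable-stable (em 0ℓ) λ i∉ → none (Injection.to exTrN-infinite i , i∉))
    (finite exTrN-infinite N)

  ∉-tabulate : ∀ {n} {ρ : Env n} {l} → l ∉ tabulate ρ → ∀ x → ρ x ≢ l
  ∉-tabulate l∉ x refl = l∉ (∈-tabulate⁺ x)

  -- It serves twice: names outside ρ can be exchanged without changing C, and every name of the
  -- history is the value of a variable, so that constant-free formulas can speak of it.
  Covers : ∀ {n} → Env n → Config → Set
  Covers ρ C = ∀ {k} → k ∈Htrn Config.hist C → ∃[ x ] ρ x ≡ k

  -- The transposition of `l` and `l′` fixes both C and ρ, and so alters only the label and the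
  -- value of the new variable.
  rename-fresh : ∀ {ℒ n ρ C C′ l l′ a} (φ : Formula ℒ (suc n)) → ConstantFree φ → Covers ρ C →
                 (∀ x → ρ x ≢ l) → (∀ x → ρ x ≢ l′) →
                 C =[ semantics ℒ ∣ l ⦅ a ⦆ ]⇒ C′ → Sat C′ φ (l ◂ ρ) →
                 ∃[ C″ ] C =[ semantics ℒ ∣ l′ ⦅ a ⦆ ]⇒ C″ × Sat C″ φ (l′ ◂ ρ)
  rename-fresh {ℒ} {ρ = ρ} {C} {C′} {l} {l′} {a} φ c cover l∉ l′∉ w sat =
    let C″ , w″ , eq = weak-renames {C} {C} (renames-fixed C fixed) w in
    C″ ,
    subst (λ l → C =[ semantics ℒ ∣ l ⦅ a ⦆ ]⇒ C″) (transposeˡ l l′) w″ ,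
    sat-renames φ {C′} {C″} c eq
      (λ { zero → sym (transposeˡ l l′) ; (suc x) → sym (transpose-≢ (l∉ x) (l′∉ x)) }) sat
    where
    open RenamingSat (transpose l l′) (transpose-involutive l l′)
    fixed : ∀ {k} → k ∈Htrn Config.hist C → transpose l l′ k ≡ k
    fixed h with cover h
    ... | x , refl = transpose-≢ (l∉ x) (l′∉ x)

  -- Hennessy–Milner properties

  Equivalent : ∀ ℒ {n} → Env n → Config → Config → Set₁
  Equivalent ℒ {n} ρ C D = ∀ (φ : Formula ℒ n) → ConstantFree φ → Sat C φ ρ → Sat D φ ρ

  -- Formulas are closed under negation, so one inclusion already gives the other.
  equivalent-sym : ∀ {ℒ n} {ρ : Env n} {C D} → Equivalent ℒ ρ C D → Equivalent ℒ ρ D C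
  equivalent-sym eq φ c sat = decidable-stable (em 0ℓ) λ ¬sat → eq (¬′ φ) c ¬sat sat

  distinguish : ∀ {ℒ n} {ρ : Env n} {C D} → ¬ Equivalent ℒ ρ C D →
                Σ[ φ ∈ Formula ℒ n ] ConstantFree φ × Sat C φ ρ × ¬ Sat D φ ρ
  distinguish neq = decidable-stable (em _) λ none →
    neq λ φ c sat → decidable-stable (em 0ℓ) λ ¬sat → none (φ , c , sat , ¬sat)

  -- Otherwise the conjunction of formulas separating C from each D i is a
  -- counterexample to the hypothesis.
  attained : ∀ {ℒ n} {ρ : Env n} {C} {I : Set} {D : I → Config} →
             (∀ (φ : Formula ℒ n) → ConstantFree φ → Sat C φ ρ → ∃[ i ] Sat (D i) φ ρ) →
             ∃[ i ] Equivalent ℒ ρ C (D i)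
  attained {I = I} sat = decidable-stable (em _) λ none →
    let d = λ i → distinguish (λ eq → none (i , eq))
        i , satᵢ = sat (⋀ I (proj₁ ∘ d)) (proj₁ ∘ proj₂ ∘ d) (proj₁ ∘ proj₂ ∘ proj₂ ∘ d)
    in proj₂ (proj₂ (proj₂ (d i))) (satᵢ i)

  htrn-star : ∀ {s C D k} → C =[ s ∣τ]⇒ D → k ∈Htrn Config.hist D → k ∈Htrn Config.hist C
  htrn-star ε h = h
  htrn-star (st ◅ sts) h with htrn-step st (htrn-star sts h)
  ... | inj₁ h′ = h′

  htrn-weak : ∀ {s C D ζ k} → C =[ s ∣ ζ ]⇒ D → k ∈Htrn Config.hist D →
              k ∈Htrn Config.hist C ⊎ k ∈ opened ζ
  htrn-weak (_ , _ , sts₁ , st , sts₂) h =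
    Sum.map₁ (htrn-star sts₁) (htrn-step st (htrn-star sts₂ h))

  abstract
    match-τ : ∀ {ℒ n} {ρ : Env n} {C C′ D} → Equivalent ℒ ρ C D → C =[ semantics ℒ ∣τ]⇒ C′ →
              ∃[ D′ ] D =[ semantics ℒ ∣τ]⇒ D′ × Equivalent ℒ ρ C′ D′
    match-τ {ℒ} {C = C} {C′} {D} eq w
      with attained {I = ∃[ D′ ] D =[ semantics ℒ ∣τ]⇒ D′} {D = proj₁}
             (λ φ c sat → let D′ , w′ , sat′ = eq (⟨τ⟩ φ) c (C′ , w , sat) in (D′ , w′) , sat′)
    ... | (D′ , w′) , eq′ = D′ , w′ , eq′

    match-act : ∀ {ℒ n} {ρ : Env n} {C C′ D l a} → Equivalent ℒ ρ C D → Covers ρ C → Covers ρ D →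
                (∀ x → ρ x ≢ l) → C =[ semantics ℒ ∣ l ⦅ a ⦆ ]⇒ C′ →
                ∃[ D′ ] D =[ semantics ℒ ∣ l ⦅ a ⦆ ]⇒ D′ × Equivalent ℒ (l ◂ ρ) C′ D′
    match-act {ℒ} {n} {ρ} {C} {C′} {D} {l} {a} eq coverC coverD l∉ w =
      let (D′ , w′) , eq′ = attained {D = proj₁} candidate in D′ , w′ , eq′
      where
      candidate : ∀ (φ : Formula ℒ (suc n)) → ConstantFree φ → Sat C′ φ (l ◂ ρ) →
                  Σ[ i ∈ (∃[ D′ ] D =[ semantics ℒ ∣ l ⦅ a ⦆ ]⇒ D′) ] Sat (proj₁ i) φ (l ◂ ρ)
      candidate φ c sat =
        let N , satD = eq (⟨x⦅ a ⦆⟩ φ) c (tabulate ρ , λ l′ l′∉ →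
                         rename-fresh φ c coverC l∉ (∉-tabulate l′∉) w sat)
            -- The cofinite set that D provides may omit `l`. A transition is therefore taken at a
            -- name outside both N and ρ, and then moved back to `l`.
            l′ , l′∉ = fresh-name (tabulate ρ ++ N)
            D′ , w′ , sat′ = satD l′ (l′∉ ∘ ∈-++⁺ʳ (tabulate ρ))
            D″ , w″ , sat″ = rename-fresh φ c coverD (∉-tabulate (l′∉ ∘ ∈-++⁺ˡ)) l∉ w′ sat′
        in (D″ , w″) , sat″

    match-co : ∀ {n} {ρ : Env n} {C C′ D K} → Equivalent ℒCanco ρ C D → Covers ρ C →
               C =[ commit-sensitive ∣ co K ]⇒ C′ →
               ∃[ D′ ] D =[ commit-sensitive ∣ co K ]⇒ D′ × Equivalent ℒCanco ρ C′ D′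
    match-co {n} {ρ} {C} {C′} {D} {K} eq cover w@(C₁ , C₂ , sts , st , _) =
      let (D′ , w′) , eq′ = attained {D = proj₁} candidate in D′ , w′ , eq′
      where
      -- K is described by the variables whose values lie in it, since the formula must not contain
      -- constants.
      K′ : Pred (Ref n) 0ℓ
      K′ v = IsVariable v × inst ρ v ∈ K
      named : ∀ {k} → k ∈ K → ∃[ x ] ρ x ≡ k
      -- A member of K is related to itself just before the commit, so it is in the history there.
      -- Silent steps do not extend the history, so it was in that of C.
      named k∈ = cover (htrn-star sts (Equivalence.to (IsConfig.E-external (Config.valid C₁) _)
                                         (commit-related (Config.valid C₁) st k∈ k∈)))
      nonempty : ∃[ v ] K′ v
      nonempty with commit-nonempty st
      ... | k , k∈ with named k∈
      ... | x , refl = inj₂ x , tt , k∈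
      named′ : ∀ {k} → k ∈ K → instSet ρ K′ k
      named′ k∈ with named k∈
      ... | x , refl = inj₂ x , (tt , k∈) , refl
      unnamed : ∀ {k} → instSet ρ K′ k → k ∈ K
      unnamed (v , (_ , k∈) , refl) = k∈
      candidate : ∀ (φ : Formula ℒCanco n) → ConstantFree φ → Sat C′ φ ρ →
                  Σ[ i ∈ (∃[ D′ ] D =[ commit-sensitive ∣ co K ]⇒ D′) ] Sat (proj₁ i) φ ρ
      candidate φ c sat with eq (⟨co⟩ K′ nonempty φ) (proj₁ , c) (K , (named′ , unnamed) , C′ , w , sat)
      ... | ks , (to , from) , D′ , (D₁ , D₂ , sts₁ , st′ , sts₂) , sat′ =
        (D′ , D₁ , D₂ , sts₁ , relabel (λ k → mk⇔ (unnamed ∘ to) (from ∘ named′)) st′ , sts₂) , sat′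

  -- Comparing the logics

  Committed : Config → exTrN → Set
  Committed C k = k ∈Hasco Config.hist C

  LiveConfig : Config → Set
  LiveConfig C = Live (Config.raw C)

  CoEqual : Config → exTrN → exTrN → Set
  CoEqual C = CoEq (Config.raw C)

  committed⇒coEqual : ∀ C {k} → Committed C k → CoEqual C k k
  committed⇒coEqual C (i , h) =
    (i , h) , (i , h) , Equivalence.from (IsConfig.E-external (Config.valid C) _) (i , _ , h)

  live-star : ∀ {s C D} → LiveConfig C → C =[ s ∣τ]⇒ D → LiveConfig D
  live-star live ε = live
  live-star {C = C} live (_◅_ {j = X} st sts) = live-star {C = X} (live-step (Config.valid C) live st) sts

  live-weak : ∀ {s ζ C D} → LiveConfig C → C =[ s ∣ ζ ]⇒ D → LiveConfig D
  live-weak {C = C} live (C₁ , C₂ , sts₁ , st , sts₂) =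
    live-star {C = C₂} (live-step (Config.valid C₁) (live-star {C = C} live sts₁) st) sts₂

  eqv-star : ∀ {s C D p} → C =[ s ∣τ]⇒ D → p ∈ Config.eqv C → p ∈ Config.eqv D
  eqv-star ε r          = r
  eqv-star (st ◅ sts) r = eqv-star sts (eqv-step st r)

  committed-step : ∀ {C D ζ k} → LiveConfig C → C —[ commit-sensitive ∣ ζ ]→ D →
                   Committed D k ⇔ (Committed C k ⊎ k ∈ committed ζ)
  committed-step {C} {D} live st = mk⇔
    (Sum.map proj₁ proj₁ ∘ coEq-step⁻ (Config.valid C) live st ∘ committed⇒coEqual D)
    (proj₁ ∘ coEq-step⁺ (Config.valid C) live st ∘ Sum.map (committed⇒coEqual C) (λ k∈ → k∈ , k∈))

  committed-star : ∀ {C D k} → LiveConfig C → C =[ extended ∣τ]⇒ D → Committed C k → Committed D k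
  committed-star live ε h = h
  committed-star {C} {D} live (_◅_ {j = X} st sts) h with sensitise (Config.valid C) st
  ... | _ , st′ , _ = committed-star {X} {D} (live-step (Config.valid C) live st) sts
    (Equivalence.from (committed-step {C} {X} live st′) (inj₁ h))

  coEq-star : ∀ {C D k k′} → LiveConfig C → C =[ commit-sensitive ∣τ]⇒ D →
              CoEqual D k k′ ⇔ CoEqual C k k′
  coEq-star live ε = mk⇔ id id
  coEq-star {C} {D} live (_◅_ {j = X} st sts)
    with coEq-star {X} {D} (live-step (Config.valid C) live st) sts
  ... | eq = mk⇔
    (fromInj₁ ∘ coEq-step⁻ (Config.valid C) live st ∘ Equivalence.to eq)
    (Equivalence.from eq ∘ coEq-step⁺ (Config.valid C) live st ∘ inj₁)
    where
    fromInj₁ : ∀ {A : Set} {k k′ : exTrN} → A ⊎ (k ∈ [] × k′ ∈ []) → A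
    fromInj₁ (inj₁ a) = a

  coEq-weak : ∀ {C D ζ k k′} → LiveConfig C → C =[ commit-sensitive ∣ ζ ]⇒ D →
              CoEqual D k k′ ⇔ (CoEqual C k k′ ⊎ (k ∈ committed ζ × k′ ∈ committed ζ))
  coEq-weak {C} {D} live (C₁ , C₂ , sts₁ , st , sts₂) = mk⇔
    (Sum.map₁ (Equivalence.to before) ∘ coEq-step⁻ (Config.valid C₁) live₁ st ∘ Equivalence.to after)
    (Equivalence.from after ∘ coEq-step⁺ (Config.valid C₁) live₁ st ∘ Sum.map₁ (Equivalence.from before))
    where
    live₁ : LiveConfig C₁
    live₁ = live-star {C = C} live sts₁
    before : ∀ {k k′} → CoEqual C₁ k k′ ⇔ CoEqual C k k′
    before = coEq-star {C} {C₁} live sts₁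
    after : ∀ {k k′} → CoEqual D k k′ ⇔ CoEqual C₂ k k′
    after = coEq-star {C₂} {D} (live-step (Config.valid C₁) live₁ st) sts₂

  committed-star⁻ : ∀ {C D k} → LiveConfig C → C =[ commit-sensitive ∣τ]⇒ D →
                    Committed D k → Committed C k
  committed-star⁻ {C} {D} live sts = proj₁ ∘ Equivalence.to (coEq-star {C} {D} live sts) ∘ committed⇒coEqual D

  forget-star : ∀ {C D} → C =[ commit-sensitive ∣τ]⇒ D → C =[ extended ∣τ]⇒ D
  forget-star = Star.map forget

  forget-co : ∀ {C D K} → C =[ commit-sensitive ∣ co K ]⇒ D → C =[ extended ∣τ]⇒ D
  forget-co (_ , _ , sts₁ , st , sts₂) = forget-star sts₁ ◅◅ forget st ◅ forget-star sts₂

  forget-act : ∀ {C D k a} → C =[ commit-sensitive ∣ k ⦅ a ⦆ ]⇒ D → C =[ extended ∣ k ⦅ a ⦆ ]⇒ D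
  forget-act (_ , _ , sts₁ , st , sts₂) = _ , _ , forget-star sts₁ , forget st , forget-star sts₂

  sensitise-act : ∀ {C D k a} → C —[ extended ∣ k ⦅ a ⦆ ]→ D → C —[ commit-sensitive ∣ k ⦅ a ⦆ ]→ D
  sensitise-act {C} st with sensitise (Config.valid C) st
  ... | _ ⦅ _ ⦆ , st′ , refl = st′

  -- A labelled commit on the way would make some name newly committed; the name would still be
  -- committed in D, against the hypothesis. Every step is thus silent in both semantics.
  sensitise-silent : ∀ {C D} → LiveConfig C → (∀ {k} → Committed D k → Committed C k) →
                     C =[ extended ∣τ]⇒ D → C =[ commit-sensitive ∣τ]⇒ D
  sensitise-silent live old ε = ε
  sensitise-silent {C} {D} live old (_◅_ {j = X} st sts) with sensitise (Config.valid C) st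
  ... | τ , st′ , refl = st′ ◅ sensitise-silent {X} {D} (live-step (Config.valid C) live st)
    (λ h → Equivalence.from (committed-step {C} {X} live st′) (inj₁ (old h))) sts
  ... | co K , st′ , refl = let k , k∈ = commit-nonempty st′ in
    contradiction
      (old (committed-star {X} {D} (live-step (Config.valid C) live st) sts
             (Equivalence.from (committed-step {C} {X} live st′) (inj₂ k∈))))
      (commit-new (Config.valid C) live st′ k∈)

  -- The first step of A that commits anything commits an element of K, hence
  -- all of K, and nothing is left to be committed afterwards.
  simultaneous : ∀ {A B K} → LiveConfig A → ∃[ k ] k ∈ K → (∀ {k} → k ∈ K → ¬ Committed A k) →
                 (∀ {k} → Committed B k ⇔ (Committed A k ⊎ k ∈ K)) →
                 (∀ {X k k′} → A =[ extended ∣τ]⇒ X → k ∈ K → k′ ∈ K → Committed X k → Committed X k′) →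
                 A =[ extended ∣τ]⇒ B → A =[ commit-sensitive ∣ co K ]⇒ B
  simultaneous live (k , k∈) unsettled all together ε =
    contradiction (Equivalence.from all (inj₂ k∈)) (unsettled k∈)
  simultaneous {A} {B} {K} live ne unsettled all together (_◅_ {j = X} st sts)
    with sensitise (Config.valid A) st
  ... | τ , st′ , refl =
    let live′ = live-step (Config.valid A) live st
        step = λ {k} → committed-step {A} {X} {k = k} live st′
        D , D′ , sts₁ , st″ , sts₂ = simultaneous {X} {B} {K} live′ ne
          (λ k∈ → unsettled k∈ ∘ fromInj₁ ∘ Equivalence.to step)
          (mk⇔ (Sum.map₁ (Equivalence.from step ∘ inj₁) ∘ Equivalence.to all)
               (Equivalence.from all ∘ Sum.map₁ (fromInj₁ ∘ Equivalence.to step)))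
          (λ w → together (st ◅ w)) sts
    in D , D′ , st′ ◅ sts₁ , st″ , sts₂
    where
    fromInj₁ : ∀ {A : Set} {k : exTrN} → A ⊎ (k ∈ []) → A
    fromInj₁ (inj₁ a) = a
  ... | co K′ , st′ , refl = A , X , ε , relabel (λ k → mk⇔ K′⊆K K⊆K′) st′ ,
    sensitise-silent {X} {B} live′ (λ h → case-all (Equivalence.to all h)) sts
    where
    live′ = live-step (Config.valid A) live st
    step : ∀ {k} → Committed X k ⇔ (Committed A k ⊎ k ∈ K′)
    step = committed-step {A} {X} live st′
    K′⊆K : ∀ {k} → k ∈ K′ → k ∈ K
    K′⊆K k∈ with Equivalence.to all (committed-star {X} {B} live′ sts (Equivalence.from step (inj₂ k∈)))
    ... | inj₁ h   = contradiction h (commit-new (Config.valid A) live st′ k∈)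
    ... | inj₂ k∈K = k∈K
    K-committed : ∀ {k} → k ∈ K → Committed X k
    K-committed k∈ = let k₀ , k₀∈ = commit-nonempty st′ in
      together {X} (st ◅ ε) (K′⊆K k₀∈) k∈ (Equivalence.from step (inj₂ k₀∈))
    K⊆K′ : ∀ {k} → k ∈ K → k ∈ K′
    K⊆K′ k∈ with Equivalence.to step (K-committed k∈)
    ... | inj₁ h    = contradiction h (unsettled k∈)
    ... | inj₂ k∈K′ = k∈K′
    case-all : ∀ {k} → Committed A k ⊎ k ∈ K → Committed X k
    case-all (inj₁ h)  = Equivalence.from step (inj₁ h)
    case-all (inj₂ k∈) = K-committed k∈

  -- Logical equivalence as a bisimulation

  record Related ℒ {n} (ρ : Env n) (C D : Config) : Set₁ where
    field
      equivalent : Equivalent ℒ ρ C D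
      coversˡ    : Covers ρ C
      coversʳ    : Covers ρ D
      liveˡ      : LiveConfig C
      liveʳ      : LiveConfig D
  open Related

  related-sym : ∀ {ℒ n} {ρ : Env n} {C D} → Related ℒ ρ C D → Related ℒ ρ D C
  related-sym {C = C} {D} r = record
    { equivalent = equivalent-sym {C = C} {D} (equivalent r)
    ; coversˡ    = coversʳ r
    ; coversʳ    = coversˡ r
    ; liveˡ      = liveʳ r
    ; liveʳ      = liveˡ r
    }

  related-τ : ∀ {ℒ n} {ρ : Env n} {C C′ D} → Related ℒ ρ C D → C =[ semantics ℒ ∣τ]⇒ C′ →
              ∃[ D′ ] D =[ semantics ℒ ∣τ]⇒ D′ × Related ℒ ρ C′ D′
  related-τ {C = C} {C′} {D} r w with match-τ {C = C} {C′} {D} (equivalent r) w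
  ... | D′ , w′ , eq = D′ , w′ , record
    { equivalent = eq
    ; coversˡ    = coversˡ r ∘ htrn-star w
    ; coversʳ    = coversʳ r ∘ htrn-star w′
    ; liveˡ      = live-star {C = C} (liveˡ r) w
    ; liveʳ      = live-star {C = D} (liveʳ r) w′
    }

  covers-act : ∀ {s n} {ρ : Env n} {C C′ l a} → Covers ρ C → C =[ s ∣ l ⦅ a ⦆ ]⇒ C′ → Covers (l ◂ ρ) C′
  covers-act cover w h with htrn-weak w h
  ... | inj₂ (here refl) = zero , refl
  ... | inj₁ h′ with cover h′
  ... | x , eq = suc x , eq

  related-act : ∀ {ℒ n} {ρ : Env n} {C C′ D l a} → Related ℒ ρ C D → (∀ x → ρ x ≢ l) →
                C =[ semantics ℒ ∣ l ⦅ a ⦆ ]⇒ C′ →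
                ∃[ D′ ] D =[ semantics ℒ ∣ l ⦅ a ⦆ ]⇒ D′ × Related ℒ (l ◂ ρ) C′ D′
  related-act {C = C} {C′} {D} r l∉ w
    with match-act {C = C} {C′} {D} (equivalent r) (coversˡ r) (coversʳ r) l∉ w
  ... | D′ , w′ , eq = D′ , w′ , record
    { equivalent = eq
    ; coversˡ    = covers-act {C = C} {C′} (coversˡ r) w
    ; coversʳ    = covers-act {C = D} {D′} (coversʳ r) w′
    ; liveˡ      = live-weak {C = C} {C′} (liveˡ r) w
    ; liveʳ      = live-weak {C = D} {D′} (liveʳ r) w′
    }

  covers-co : ∀ {n} {ρ : Env n} {C C′ K} → Covers ρ C → C =[ commit-sensitive ∣ co K ]⇒ C′ → Covers ρ C′
  covers-co cover w h with htrn-weak w h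
  ... | inj₁ h′ = cover h′

  related-co : ∀ {n} {ρ : Env n} {C C′ D K} → Related ℒCanco ρ C D →
               C =[ commit-sensitive ∣ co K ]⇒ C′ →
               ∃[ D′ ] D =[ commit-sensitive ∣ co K ]⇒ D′ × Related ℒCanco ρ C′ D′
  related-co {C = C} {C′} {D} r w with match-co {C = C} {C′} {D} (equivalent r) (coversˡ r) w
  ... | D′ , w′ , eq = D′ , w′ , record
    { equivalent = eq
    ; coversˡ    = covers-co {C = C} {C′} (coversˡ r) w
    ; coversʳ    = covers-co {C = D} {D′} (coversʳ r) w′
    ; liveˡ      = live-weak {C = C} {C′} (liveˡ r) w
    ; liveʳ      = live-weak {C = D} {D′} (liveʳ r) w′
    }

  -- Matching commit-sensitive transitions from `ℒHasco`

  hasco-agree : ∀ {n} {ρ : Env n} {C D k} → Related ℒHasco ρ C D → Committed C k → Committed D k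
  hasco-agree r (i , h) with coversˡ r (i , _ , h)
  ... | x , refl = equivalent r (Hasco (inj₂ x)) tt (i , h)

  -- C commits no external name on the way to C′. The two sides agree on committed names at both
  -- ends, so the answer of D commits none either and is silent in the finer semantics.
  canco-τ : ∀ {n} {ρ : Env n} {C C′ D} → Related ℒHasco ρ C D → C =[ commit-sensitive ∣τ]⇒ C′ →
            ∃[ D′ ] D =[ commit-sensitive ∣τ]⇒ D′ × Related ℒHasco ρ C′ D′
  canco-τ {C = C} {C′} {D} r w with related-τ {C = C} {C′} {D} r (forget-star w)
  ... | D′ , w′ , r′ = D′ , sensitise-silent {D} {D′} (liveʳ r) old w′ , r′
    where
    old : ∀ {k} → Committed D′ k → Committed D k
    old = hasco-agree {C = C} {D} r ∘ committed-star⁻ {C} {C′} (liveˡ r) w ∘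
          hasco-agree {C = D′} {C′} (related-sym {C = C′} {D′} r′)

  committed-act : ∀ {C C′ l a k} → LiveConfig C → C =[ commit-sensitive ∣ l ⦅ a ⦆ ]⇒ C′ →
                  Committed C′ k → Committed C k
  committed-act {C} {C′} live w h with Equivalence.to (coEq-weak {C} {C′} live w) (committed⇒coEqual C′ h)
  ... | inj₁ (h′ , _) = h′

  canco-act : ∀ {n} {ρ : Env n} {C C′ D l a} → Related ℒHasco ρ C D → (∀ x → ρ x ≢ l) →
              C =[ commit-sensitive ∣ l ⦅ a ⦆ ]⇒ C′ →
              ∃[ D′ ] D =[ commit-sensitive ∣ l ⦅ a ⦆ ]⇒ D′ × Related ℒHasco (l ◂ ρ) C′ D′
  canco-act {C = C} {C′} {D} r l∉ w with related-act {C = C} {C′} {D} r l∉ (forget-act {C} {C′} w)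
  ... | D′ , (D₁ , D₂ , sts₁ , st , sts₂) , r′ = D′ ,
    ( D₁ , D₂
    -- From D to D′ nothing is newly committed (`old`), and commits persist. Names committed at D₁
    -- persist to D′ and so are old in D; names committed at D′ are old in D and so are committed at
    -- D₂.
    , sensitise-silent {D} {D₁} (liveʳ r) (old ∘ committed-star {D₂} {D′} live₂ sts₂ ∘ step) sts₁
    , st′
    , sensitise-silent {D₂} {D′} live₂ (step ∘ committed-star {D} {D₁} (liveʳ r) sts₁ ∘ old) sts₂
    ) , r′
    where
    live₁ : LiveConfig D₁
    live₁ = live-star {C = D} (liveʳ r) sts₁
    live₂ : LiveConfig D₂
    live₂ = live-step (Config.valid D₁) live₁ st
    st′ = sensitise-act {D₁} {D₂} st
    step : ∀ {k} → Committed D₁ k → Committed D₂ k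
    step = Equivalence.from (committed-step {D₁} {D₂} live₁ st′) ∘ inj₁
    old : ∀ {k} → Committed D′ k → Committed D k
    old = hasco-agree {C = C} {D} r ∘ committed-act {C} {C′} (liveˡ r) w ∘
          hasco-agree {C = D′} {C′} (related-sym {C = C′} {D′} r′)

  -- K is already an equivalence class when it is committed.  No configuration
  -- reachable from there commits only part of K, and this passes through the
  -- equivalence.
  canco-commit : ∀ {n} {ρ : Env n} {C C′ D K} → Related ℒHasco ρ C D →
                 C —[ commit-sensitive ∣ co K ]→ C′ →
                 ∃[ D′ ] D =[ commit-sensitive ∣ co K ]⇒ D′ × Related ℒHasco ρ C′ D′
  canco-commit {C = C} {C′} {D} {K} r st with related-τ {C = C} {C′} {D} r (forget st ◅ ε)
  ... | D′ , w , r′ = D′ , simultaneous {D} {D′} {K} (liveʳ r) (commit-nonempty st) unsettled all together w , r′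
    where
    step : ∀ {k} → Committed C′ k ⇔ (Committed C k ⊎ k ∈ K)
    step = committed-step {C} {C′} (liveˡ r) st
    unsettled : ∀ {k} → k ∈ K → ¬ Committed D k
    unsettled k∈ h = commit-new (Config.valid C) (liveˡ r) st k∈
      (hasco-agree {C = D} {C} (related-sym {C = C} {D} r) h)
    all : ∀ {k} → Committed D′ k ⇔ (Committed D k ⊎ k ∈ K)
    all = mk⇔
      (Sum.map₁ (hasco-agree {C = C} {D} r) ∘ Equivalence.to step ∘
       hasco-agree {C = D′} {C′} (related-sym {C = C′} {D′} r′))
      (hasco-agree {C = C′} {D′} r′ ∘ Equivalence.from step ∘
       Sum.map₁ (hasco-agree {C = D} {C} (related-sym {C = C} {D} r)))
    together : ∀ {X k k′} → D =[ extended ∣τ]⇒ X → k ∈ K → k′ ∈ K → Committed X k → Committed X k′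
    -- C answers X with some Y in which K still lies in one class, because E only grows. There
    -- `E-hasco` forces the members to agree, and the equivalence carries this back to X.
    together {X} w k∈ k′∈ h with related-τ {C = D} {X} {C} (related-sym {C = C} {D} r) w
    ... | Y , v , q = hasco-agree {C = Y} {X} (related-sym {C = X} {Y} q)
      (Equivalence.to
        (IsConfig.E-hasco (Config.valid Y) (eqv-star v (commit-related (Config.valid C) st k∈ k′∈)))
        (hasco-agree {C = X} {Y} q h))

  canco-co : ∀ {n} {ρ : Env n} {C C′ D K} → Related ℒHasco ρ C D →
             C =[ commit-sensitive ∣ co K ]⇒ C′ →
             ∃[ D′ ] D =[ commit-sensitive ∣ co K ]⇒ D′ × Related ℒHasco ρ C′ D′
  canco-co {C = C} {C′} {D} r (C₁ , C₂ , sts₁ , st , sts₂) =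
    let D₁ , w₁ , r₁ = canco-τ {C = C} {C₁} {D} r sts₁
        D₂ , (A , B , v₁ , st′ , v₂) , r₂ = canco-commit {C = C₁} {C₂} {D₁} r₁ st
        D′ , w₂ , r′ = canco-τ {C = C₂} {C′} {D₂} r₂ sts₂
    in D′ , (A , B , w₁ ◅◅ v₁ , st′ , v₂ ◅◅ w₂) , r′

  -- The environment ρ′ of the formula is independent of the ρ that indexes the relation: the two
  -- sides perform the same labels, names included, so constants and all values of variables mean
  -- the same on both. The names of ρ are merely added to the exceptions of `⟨x⦅ a ⦆⟩`.
  transfer-canco : ∀ {n m} {ρ : Env n} {ρ′ : Env m} {C D} → Related ℒHasco ρ C D →
                   (φ : Formula ℒCanco m) → Sat C φ ρ′ → Sat D φ ρ′
  transfer-canco {C = C} {D} r (⟨τ⟩ φ) (C′ , w , sat) =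
    let D′ , w′ , r′ = canco-τ {C = C} {C′} {D} r w in D′ , w′ , transfer-canco r′ φ sat
  transfer-canco {ρ = ρ} {C = C} {D} r (⟨x⦅ a ⦆⟩ φ) (N , sat) = tabulate ρ ++ N , λ l l∉ →
    let C′ , w , satC = sat l (l∉ ∘ ∈-++⁺ʳ (tabulate ρ))
        D′ , w′ , r′ = canco-act {C = C} {C′} {D} r (∉-tabulate (l∉ ∘ ∈-++⁺ˡ)) w
    in D′ , w′ , transfer-canco r′ φ satC
  transfer-canco {C = C} {D} r (¬′ φ) ¬sat sat =
    ¬sat (transfer-canco {C = D} {C} (related-sym {C = C} {D} r) φ sat)
  transfer-canco r (⋀ M φ) sat i = transfer-canco r (φ i) (sat i)
  transfer-canco {C = C} {D} r (⟨co⟩ K _ φ) (ks , eq , C′ , w , sat) =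
    let D′ , w′ , r′ = canco-co {C = C} {C′} {D} r w in ks , eq , D′ , w′ , transfer-canco r′ φ sat

  -- Matching extended transitions from `ℒCanco`

  record CoRelated {n} (ρ : Env n) (C D : Config) : Set₁ where
    field
      related : Related ℒCanco ρ C D
      coEq    : ∀ {k k′} → CoEqual C k k′ ⇔ CoEqual D k k′
  open CoRelated

  coRelated-sym : ∀ {n} {ρ : Env n} {C D} → CoRelated ρ C D → CoRelated ρ D C
  coRelated-sym {C = C} {D} r = record
    { related = related-sym {C = C} {D} (related r)
    ; coEq    = mk⇔ (Equivalence.from (coEq r)) (Equivalence.to (coEq r))
    }

  coRelated-star : ∀ {n} {ρ : Env n} {C C′ D D′} → CoRelated ρ C D →
                   C =[ commit-sensitive ∣τ]⇒ C′ → D =[ commit-sensitive ∣τ]⇒ D′ →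
                   Related ℒCanco ρ C′ D′ → CoRelated ρ C′ D′
  coRelated-star {C = C} {C′} {D} {D′} r w v r′ = record
    { related = r′
    ; coEq    = mk⇔
        (Equivalence.from target ∘ Equivalence.to (coEq r) ∘ Equivalence.to source)
        (Equivalence.from source ∘ Equivalence.from (coEq r) ∘ Equivalence.to target)
    }
    where
    source : ∀ {k k′} → CoEqual C′ k k′ ⇔ CoEqual C k k′
    source = coEq-star {C} {C′} (liveˡ (related r)) w
    target : ∀ {k k′} → CoEqual D′ k k′ ⇔ CoEqual D k k′
    target = coEq-star {D} {D′} (liveʳ (related r)) v

  coRelated-weak : ∀ {n n′} {ρ : Env n} {ρ′ : Env n′} {C C′ D D′ ζ} → CoRelated ρ C D →
                   C =[ commit-sensitive ∣ ζ ]⇒ C′ → D =[ commit-sensitive ∣ ζ ]⇒ D′ →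
                   Related ℒCanco ρ′ C′ D′ → CoRelated ρ′ C′ D′
  coRelated-weak {C = C} {C′} {D} {D′} {ζ} r w v r′ = record
    { related = r′
    ; coEq    = mk⇔
        (Equivalence.from target ∘ Sum.map₁ (Equivalence.to (coEq r)) ∘ Equivalence.to source)
        (Equivalence.from source ∘ Sum.map₁ (Equivalence.from (coEq r)) ∘ Equivalence.to target)
    }
    where
    source : ∀ {k k′} → CoEqual C′ k k′ ⇔ (CoEqual C k k′ ⊎ (k ∈ committed ζ × k′ ∈ committed ζ))
    source = coEq-weak {C} {C′} (liveˡ (related r)) w
    target : ∀ {k k′} → CoEqual D′ k k′ ⇔ (CoEqual D k k′ ⊎ (k ∈ committed ζ × k′ ∈ committed ζ))
    target = coEq-weak {D} {D′} (liveʳ (related r)) v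

  -- A sequence of extended τ-steps may hide several commits with different labels, so it is matched
  -- step by step. Each step is either silent or a commit of some K, and the answer to a commit
  -- becomes silent again once its label is forgotten.
  eq-step : ∀ {n} {ρ : Env n} {C C′ D} → CoRelated ρ C D → C —[ extended ∣ τ ]→ C′ →
            ∃[ D′ ] D =[ extended ∣τ]⇒ D′ × CoRelated ρ C′ D′
  eq-step {C = C} {C′} {D} r st with sensitise (Config.valid C) st
  ... | τ , st′ , refl =
    let D′ , w , r′ = related-τ {C = C} {C′} {D} (related r) (st′ ◅ ε)
    in D′ , forget-star w , coRelated-star {C = C} {C′} {D} {D′} r (st′ ◅ ε) w r′
  ... | co K , st′ , refl =
    let v = C , C′ , ε , st′ , ε
        D′ , w , r′ = related-co {C = C} {C′} {D} (related r) v
    in D′ , forget-co {D} {D′} w , coRelated-weak {C = C} {C′} {D} {D′} r v w r′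

  eq-τ : ∀ {n} {ρ : Env n} {C C′ D} → CoRelated ρ C D → C =[ extended ∣τ]⇒ C′ →
         ∃[ D′ ] D =[ extended ∣τ]⇒ D′ × CoRelated ρ C′ D′
  eq-τ {D = D} r ε = D , ε , r
  eq-τ {C = C} {C′} {D} r (_◅_ {j = X} st sts) =
    let Y  , w  , q  = eq-step {C = C} {X} {D} r st
        D′ , w′ , r′ = eq-τ {C = X} {C′} {Y} q sts
    in D′ , w ◅◅ w′ , r′

  -- The steps around the action may contain commits, and then form no weak commit-sensitive
  -- transition. Hence the action alone is matched in that semantics, and the two silent parts by
  -- `eq-τ`.
  eq-act : ∀ {n} {ρ : Env n} {C C′ D l a} → CoRelated ρ C D → (∀ x → ρ x ≢ l) →
           C =[ extended ∣ l ⦅ a ⦆ ]⇒ C′ →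
           ∃[ D′ ] D =[ extended ∣ l ⦅ a ⦆ ]⇒ D′ × CoRelated (l ◂ ρ) C′ D′
  eq-act {C = C} {C′} {D} r l∉ (C₁ , C₂ , sts₁ , st , sts₂) =
    let D₁ , w₁ , r₁ = eq-τ {C = C} {C₁} {D} r sts₁
        v = C₁ , C₂ , ε , sensitise-act {C₁} {C₂} st , ε
        D₂ , w , q = related-act {C = C₁} {C₂} {D₁} (related r₁) l∉ v
        A , B , v₁ , st′ , v₂ = forget-act {D₁} {D₂} w
        D′ , w₂ , r′ = eq-τ {C = C₂} {C′} {D₂} (coRelated-weak {C = C₁} {C₂} {D₁} {D₂} r₁ v w q) sts₂
    in D′ , (A , B , w₁ ◅◅ v₁ , st′ , v₂ ◅◅ w₂) , r′

  transfer-eq : ∀ {n m} {ρ : Env n} {ρ′ : Env m} {C D} → CoRelated ρ C D →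
                (φ : Formula ℒEq m) → Sat C φ ρ′ → Sat D φ ρ′
  transfer-eq {C = C} {D} r (⟨τ⟩ φ) (C′ , w , sat) =
    let D′ , w′ , r′ = eq-τ {C = C} {C′} {D} r w in D′ , w′ , transfer-eq r′ φ sat
  transfer-eq {ρ = ρ} {C = C} {D} r (⟨x⦅ a ⦆⟩ φ) (N , sat) = tabulate ρ ++ N , λ l l∉ →
    let C′ , w , satC = sat l (l∉ ∘ ∈-++⁺ʳ (tabulate ρ))
        D′ , w′ , r′ = eq-act {C = C} {C′} {D} r (∉-tabulate (l∉ ∘ ∈-++⁺ˡ)) w
    in D′ , w′ , transfer-eq r′ φ satC
  transfer-eq {C = C} {D} r (¬′ φ) ¬sat sat =
    ¬sat (transfer-eq {C = D} {C} (coRelated-sym {C = C} {D} r) φ sat)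
  transfer-eq r (⋀ M φ) sat i = transfer-eq r (φ i) (sat i)
  transfer-eq r (v =co w) sat = Equivalence.to (coEq r) sat

  -- Translating `ℒHasco` into `ℒEq`, and the three comparisons

  hasco⇒eq : ∀ {n} → Formula ℒHasco n → Formula ℒEq n
  hasco⇒eq (⟨τ⟩ φ)      = ⟨τ⟩ hasco⇒eq φ
  hasco⇒eq (⟨x⦅ a ⦆⟩ φ) = ⟨x⦅ a ⦆⟩ hasco⇒eq φ
  hasco⇒eq (¬′ φ)       = ¬′ hasco⇒eq φ
  hasco⇒eq (⋀ M φ)      = ⋀ M (λ i → hasco⇒eq (φ i))
  hasco⇒eq (Hasco v)    = v =co v

  sat-hasco⇒eq : ∀ {n} (φ : Formula ℒHasco n) {C} {ρ : Env n} → Sat C φ ρ ⇔ Sat C (hasco⇒eq φ) ρ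
  sat-hasco⇒eq (⟨τ⟩ φ) = mk⇔
    (λ (C′ , w , sat) → C′ , w , Equivalence.to (sat-hasco⇒eq φ) sat)
    (λ (C′ , w , sat) → C′ , w , Equivalence.from (sat-hasco⇒eq φ) sat)
  sat-hasco⇒eq (⟨x⦅ a ⦆⟩ φ) = mk⇔
    (λ (N , sat) → N , λ l l∉ → let C′ , w , satC = sat l l∉ in
      C′ , w , Equivalence.to (sat-hasco⇒eq φ) satC)
    (λ (N , sat) → N , λ l l∉ → let C′ , w , satC = sat l l∉ in
      C′ , w , Equivalence.from (sat-hasco⇒eq φ) satC)
  sat-hasco⇒eq (¬′ φ) = mk⇔ (_∘ Equivalence.from (sat-hasco⇒eq φ)) (_∘ Equivalence.to (sat-hasco⇒eq φ))
  sat-hasco⇒eq (⋀ M φ) = mk⇔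
    (λ sat i → Equivalence.to (sat-hasco⇒eq (φ i)) (sat i))
    (λ sat i → Equivalence.from (sat-hasco⇒eq (φ i)) (sat i))
  -- A committed name is in the history, so `E-external` relates it to itself.
  sat-hasco⇒eq (Hasco v) {C} = mk⇔ (committed⇒coEqual C) proj₁

  -- `_⊨_` evaluates every formula in an empty environment of its own; without
  -- function extensionality these are only pointwise equal.
  sat-env : ∀ {ℒ n} (φ : Formula ℒ n) {C} {ρ ρ′ : Env n} → ConstantFree φ → (∀ x → ρ′ x ≡ ρ x) →
            Sat C φ ρ → Sat C φ ρ′
  sat-env φ {C} c = sat-renames φ {C} {C} c (renames-fixed C (λ _ → refl))
    where open RenamingSat id (λ _ → refl)

  initial-related : ∀ {ℒ} P Q (p : Internal P) (q : Internal Q) → ℒ ⟦ P , p ⟧ ≐ ℒ ⟦ Q , q ⟧ →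
                    Related ℒ (λ ()) (initial P p) (initial Q q)
  initial-related P Q p q (to , _) = record
    { equivalent = λ φ c sat →
        sat-env φ {initial Q q} c (λ ()) (to {φ} (sat-env φ {initial P p} c (λ ()) sat))
    ; coversˡ    = λ { (_ , _ , ()) }
    ; coversʳ    = λ { (_ , _ , ()) }
    ; liveˡ      = λ _ ()
    ; liveʳ      = λ _ ()
    }

  canco≼hasco : ℒCanco ≼ ℒHasco
  canco≼hasco P Q p q same =
    (λ {φ} → transfer-canco r φ) , (λ {φ} → transfer-canco (related-sym {C = initial P p} {initial Q q} r) φ)
    where r = initial-related P Q p q same

  hasco≼eq : ℒHasco ≼ ℒEq
  hasco≼eq P Q p q (to , from) =
    (λ {φ} → Equivalence.from (sat-hasco⇒eq φ) ∘ to {hasco⇒eq φ} ∘ Equivalence.to (sat-hasco⇒eq φ)) ,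
    (λ {φ} → Equivalence.from (sat-hasco⇒eq φ) ∘ from {hasco⇒eq φ} ∘ Equivalence.to (sat-hasco⇒eq φ))

  eq≼canco : ℒEq ≼ ℒCanco
  eq≼canco P Q p q same =
    (λ {φ} → transfer-eq r φ) , (λ {φ} → transfer-eq (coRelated-sym {C = initial P p} {initial Q q} r) φ)
    where
    r = record
      { related = initial-related P Q p q same
      ; coEq    = mk⇔ (λ { ((_ , ()) , _) }) (λ { ((_ , ()) , _) })
      }

theorem5p6 : (∀ ℓ → ExcludedMiddle ℓ) → (S : Signature) → let open TCCS S in
    (ℒCanco ≼ ℒHasco) × (ℒHasco ≼ ℒEq) × (ℒEq ≼ ℒCanco)
theorem5p6 em S = canco≼hasco , hasco≼eq , eq≼canco
  where open Comparison em S
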